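{- There are two upward planar drawings of an $n$-vertex upward plane path such that any upward planar morph between them consists of $\Omega(n)$ steps. That is, there are absolute constants $c>0$ and $n_0$ such that for every $n\ge n_0$ there exist an $n$-vertex upward plane graph $P$ whose underlying graph is a path and two upward planar drawings $\Gamma_0,\Gamma_1$ of $P$ (both respecting the upward planar embedding of $P$) such that every $k$-step upward planar morph from $\Gamma_0$ to $\Gamma_1$ has $k\ge c\,n$.
   Context: All graphs are finite. All drawings are straight-line: vertices are distinct points of the plane and each edge is the straight-line segment between its end-vertices. A drawing is planar if no two edges intersect (except at common end-vertices). For a directed graph, $uv$ denotes an edge directed from $u$ to $v$ ($v$ is a successor of $u$, and $u$ a predecessor of $v$); the underlying graph is obtained by omitting edge directions. A drawing of a directed graph is upward planar if it is planar and each edge $uv$ is monotonically increasing in the $y$-direction from $u$ to $v$; a directed graph is upward planar if it admits such a drawing. In an upward planar drawing, $\mathcal S(v)$ (resp. $\mathcal P(v)$) is the list of the successors (resp. predecessors) of $v$ in left-to-right order around $v$. Two upward planar drawings of a connected directed graph are topologically equivalent if they have the same lists $\mathcal S(v)$ and $\mathcal P(v)$ for each vertex $v$. An upward planar embedding is an equivalence class of upward planar drawings; an upward plane graph is an upward planar graph equipped with an upward planar embedding. Every upward planar drawing of an upward plane graph is assumed to respect its upward planar embedding. A morphing step (or step) is a linear morph $\langle\Gamma,\Gamma'\rangle$: every vertex moves along a straight-line trajectory at uniform speed from its position in $\Gamma$ to its position in $\Gamma'$ (trajectories of different vertices may differ). A $k$-step morph from $\Gamma_0$ to $\Gamma_1$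 is a sequence $\langle\Gamma_0=\Lambda_1,\Lambda_2,\dots,\Lambda_{k+1}=\Gamma_1\rangle$ of drawings, consecutive ones being connected by linear morphs. It is an upward planar morph if the drawing at every time instant is an upward planar drawing of the upward plane graph. -}

module Defs where

open import Algebra.Apartness.Bundles using (HeytingField; HeytingCommutativeRing)
open import Algebra.Bundles using (CommutativeRing)
import Algebra.Definitions.RawMonoid as RawMonoid
open import Data.Fin.Base using (Fin; inject₁; fromℕ; toℕ)
open import Data.Fin.Permutation using (Permutation′; _⟨$⟩ʳ_)
open import Data.List.Base using (List)
open import Data.List.Membership.Propositional using (_∈_)
open import Data.List.Relation.Unary.AllPairs using (AllPairs)
open import Data.Nat.Base as ℕ using (ℕ)
open import Data.Product.Base using (∃-syntax; _×_; _,_; proj₁; proj₂)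
open import Data.Sum.Base using (_⊎_)
open import Function.Bundles using (_⇔_)
open import Level using (Level; _⊔_; 0ℓ) renaming (suc to lsuc)
open import Relation.Binary.Core using (Rel)
open import Relation.Binary.Definitions using (Decidable)
open import Relation.Binary.PropositionalEquality using (_≡_; _≢_)
open import Relation.Binary.Structures using (IsStrictPartialOrder)
open import Relation.Nullary.Negation using (¬_)

-- The real numbers, axiomatised as a Cauchy-complete Archimedean ordered
-- field.  Classically these axioms determine ℝ up to isomorphism; they are
-- phrased so that Bishop's constructive reals satisfy them as well.

record RealField c ℓ₁ ℓ₂ ℓ₃ : Set (lsuc (c ⊔ ℓ₁ ⊔ ℓ₂ ⊔ ℓ₃)) where
  field
    heytingField : HeytingField c ℓ₁ ℓ₂

  open HeytingField heytingField public
    using (Carrier; _≈_; _#_; _+_; _*_; -_; _-_; 0#; 1#;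
           heytingCommutativeRing)
  open HeytingCommutativeRing heytingCommutativeRing public
    using (commutativeRing)
  open CommutativeRing commutativeRing using (+-rawMonoid)

  infix 4 _<_ _≤_

  field
    _<_                    : Rel Carrier ℓ₃
    <-isStrictPartialOrder : IsStrictPartialOrder _≈_ _<_
    #⇔<⊎>                  : ∀ {x y} → x # y ⇔ (x < y ⊎ y < x)
    0<1                    : 0# < 1#
    +-monoˡ-<              : ∀ z {x y} → x < y → x + z < y + z
    *-pos                  : ∀ {x y} → 0# < x → 0# < y → 0# < x * y

  _≤_ : Rel Carrier ℓ₃
  x ≤ y = ¬ (y < x)

  fromNat : ℕ → Carrier
  fromNat n = RawMonoid._×_ +-rawMonoid n 1#

  -- ∣ x - y ∣ < ε
  Within : Carrier → Carrier → Carrier → Set ℓ₃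
  Within ε x y = x - y < ε × y - x < ε

  IsCauchy : (ℕ → Carrier) → Set (c ⊔ ℓ₃)
  IsCauchy a = ∀ ε → 0# < ε →
    ∃[ N ] (∀ m n → N ℕ.≤ m → N ℕ.≤ n → Within ε (a m) (a n))

  _ConvergesTo_ : (ℕ → Carrier) → Carrier → Set (c ⊔ ℓ₃)
  a ConvergesTo x = ∀ ε → 0# < ε →
    ∃[ N ] (∀ n → N ℕ.≤ n → Within ε (a n) x)

  field
    archimedean : ∀ x → ∃[ n ] x < fromNat n
    complete    : ∀ a → IsCauchy a → ∃[ x ] a ConvergesTo x


record Digraph (n : ℕ) : Set₁ where
  infix 4 _⟶_ _⟶?_
  field
    _⟶_  : Rel (Fin n) 0ℓ
    _⟶?_ : Decidable _⟶_

  -- adjacency in the underlying graph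
  _∼_ : Rel (Fin n) 0ℓ
  u ∼ v = u ⟶ v ⊎ v ⟶ u

-- The underlying graph is a path on all n vertices; π gives the position of
-- each vertex along the path.
UnderlyingPath : ∀ {n} → Digraph n → Set
UnderlyingPath {n} G = ∃[ π ] (∀ u v → u ∼ v ⇔ Consecutive π u v)
  where
  open Digraph G
  Consecutive : Permutation′ n → Rel (Fin n) 0ℓ
  Consecutive π u v =
      toℕ (π ⟨$⟩ʳ v) ≡ ℕ.suc (toℕ (π ⟨$⟩ʳ u))
    ⊎ toℕ (π ⟨$⟩ʳ u) ≡ ℕ.suc (toℕ (π ⟨$⟩ʳ v))


module Drawings {c ℓ₁ ℓ₂ ℓ₃ : Level} (R : RealField c ℓ₁ ℓ₂ ℓ₃) where

  open RealField R

  Point : Set c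
  Point = Carrier × Carrier

  xOf yOf : Point → Carrier
  xOf = proj₁
  yOf = proj₂

  infix 4 _≈ₚ_
  _≈ₚ_ : Rel Point ℓ₁
  p ≈ₚ q = xOf p ≈ xOf q × yOf p ≈ yOf q

  UnitInterval : Carrier → Set ℓ₃
  UnitInterval t = 0# ≤ t × t ≤ 1#

  -- The point at parameter t on the segment from p to q.
  lerp : Carrier → Point → Point → Point
  lerp t p q =
      (1# - t) * xOf p + t * xOf q
    , (1# - t) * yOf p + t * yOf q

  -- A straight-line drawing is determined by the positions of the vertices.
  Drawing : ℕ → Set c
  Drawing n = Fin n → Point

  infix 4 _≈ᵈ_
  _≈ᵈ_ : ∀ {n} → Rel (Drawing n) ℓ₁
  Γ ≈ᵈ Γ′ = ∀ v → Γ v ≈ₚ Γ′ v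

  module _ {n : ℕ} (G : Digraph n) (Γ : Drawing n) where

    open Digraph G

    VerticesDistinct : Set ℓ₁
    VerticesDistinct = ∀ {u v} → u ≢ v → ¬ (Γ u ≈ₚ Γ v)

    Planar : Set (c ⊔ ℓ₁ ⊔ ℓ₃)
    Planar = ∀ {u v u′ v′} → u ⟶ v → u′ ⟶ v′ → (u , v) ≢ (u′ , v′) →
      ∀ {s t} → UnitInterval s → UnitInterval t →
      lerp s (Γ u) (Γ v) ≈ₚ lerp t (Γ u′) (Γ v′) →
      ∃[ w ] (w ≡ u ⊎ w ≡ v) × (w ≡ u′ ⊎ w ≡ v′) ×
             lerp s (Γ u) (Γ v) ≈ₚ Γ w

    Upward : Set (c ⊔ ℓ₃)
    Upward = ∀ {u v} → u ⟶ v →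
      ∀ {s t} → UnitInterval s → UnitInterval t → s < t →
      yOf (lerp s (Γ u) (Γ v)) < yOf (lerp t (Γ u) (Γ v))

    record UpwardPlanarDrawing : Set (c ⊔ ℓ₁ ⊔ ℓ₃) where
      field
        distinct : VerticesDistinct
        planar   : Planar
        upward   : Upward

    -- u is to the left of w around v: every horizontal line that meets both
    -- the edges between v and u and between v and w, other than at v, meets
    -- the former to the left of the latter.  Used when u and w are both
    -- successors or both predecessors of v, so that such lines exist.
    LeftOf : Fin n → Fin n → Fin n → Set (c ⊔ ℓ₁ ⊔ ℓ₃)
    LeftOf v u w = ∀ {s t} →
      0# < s → s ≤ 1# → 0# < t → t ≤ 1# →
      yOf (lerp s (Γ v) (Γ u)) ≈ yOf (lerp t (Γ v) (Γ w)) →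
      xOf (lerp s (Γ v) (Γ u)) < xOf (lerp t (Γ v) (Γ w))

    -- l is 𝒮(v), respectively 𝒫(v), in the drawing Γ.
    SuccessorList PredecessorList : Fin n → List (Fin n) → Set (c ⊔ ℓ₁ ⊔ ℓ₃)
    SuccessorList   v l = (∀ u → u ∈ l ⇔ v ⟶ u) × AllPairs (LeftOf v) l
    PredecessorList v l = (∀ u → u ∈ l ⇔ u ⟶ v) × AllPairs (LeftOf v) l

    -- Γ is an upward planar drawing of G whose lists are 𝒮 and 𝒫.
    record Realises (𝒮 𝒫 : Fin n → List (Fin n)) : Set (c ⊔ ℓ₁ ⊔ ℓ₃) where
      field
        upwardPlanar : UpwardPlanarDrawing
        successors   : ∀ v → SuccessorList v (𝒮 v)
        predecessors : ∀ v → PredecessorList v (𝒫 v)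

  -- An upward planar embedding is a class of drawings with the same lists
  -- 𝒮(v) and 𝒫(v), so it is given by these lists; `realisable` says that the
  -- class is inhabited.
  record UpwardPlaneGraph (n : ℕ) : Set (lsuc 0ℓ ⊔ c ⊔ ℓ₁ ⊔ ℓ₃) where
    field
      digraph    : Digraph n
      𝒮 𝒫        : Fin n → List (Fin n)
      realisable : ∃[ Γ ] Realises digraph Γ 𝒮 𝒫

    IsDrawing : Drawing n → Set (c ⊔ ℓ₁ ⊔ ℓ₃)
    IsDrawing Γ = Realises digraph Γ 𝒮 𝒫

  -- The drawing at time t of the linear morph ⟨ Γ , Γ′ ⟩.
  linearMorph : ∀ {n} → Drawing n → Drawing n → Carrier → Drawing n
  linearMorph Γ Γ′ t v = lerp t (Γ v) (Γ′ v)

  record UpwardPlanarMorph {n} (P : UpwardPlaneGraph n) (k : ℕ)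
                           (Γ₀ Γ₁ : Drawing n) : Set (c ⊔ ℓ₁ ⊔ ℓ₃) where
    open UpwardPlaneGraph P
    field
      Λ       : Fin (ℕ.suc k) → Drawing n
      start   : Λ Fin.zero ≈ᵈ Γ₀
      end     : Λ (fromℕ k) ≈ᵈ Γ₁
      drawing : ∀ i → IsDrawing (Λ i)
      step    : ∀ (i : Fin k) {t} → UnitInterval t →
                IsDrawing (linearMorph (Λ (inject₁ i)) (Λ (Fin.suc i)) t)

{-# OPTIONS --safe #-}
module Submission where

-- The vertices of the path alternate between sources and sinks and all its turns are clockwise, so
-- that a drawing is a spiral; Γ₀ spirals inward and Γ₁ outward.  For consecutive edges a, b, c of
-- heights h₀, h₁, h₂, put α = - a × b > 0, β = - b × c > 0 and δ = a × c.  Then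
-- h₁ δ = h₀ β + h₂ α, and a meets c iff δ ≥ α and δ ≥ β.
--
-- Call the triple critical if h₁ ≥ h₀ + h₂.  In a drawing, the middle one of three consecutive edges
-- is never the shortest, so the heights are unimodal and at most one triple is critical.  Criticality
-- is an inequality between the y-coordinates of two vertices, so if a triple is critical at neither
-- end of a linear step, it is never critical during the step.  Then δ - α cannot change sign in the
-- step: it is quadratic in time, and δ = α without criticality forces δ > β, so that a meets c.  As
-- δ - α is negative in Γ₀ and positive in Γ₁, each of the n - 3 triples is critical in one of the
-- k + 1 drawings Λ, and no two triples in the same one.

-- In the code, `orient p₀ p₁ p₃` is δ - α and `orient p₂ p₃ p₀` is δ - β. So the sign of δ - α
-- tells on which side of the line through the first edge the last vertex lies, and this is what
-- reverses between an inward and an outward spiral. The axioms of `RealField` admit constructive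
-- models, which shapes two steps. A sign change of a continuous function does not yield an exact
-- zero there, so the zero of δ - α is obtained by solving the quadratic; its discriminant needs a
-- square root, which comes from Cauchy completeness. Criticality is not decidable either, so that a
-- triple becomes critical is only known up to double negation; this suffices because the final
-- comparison of m with k + 1 is between natural numbers and hence decidable.

open import Defs
open import Algebra.Apartness.Bundles using (HeytingField)
import Algebra.Apartness.Properties.HeytingCommutativeRing as HCRProperties
open import Algebra.Bundles using (CommutativeRing)
import Algebra.Properties.Ring as RingProperties
import Algebra.Properties.Semiring.Mult as Mult
import Algebra.Properties.Semiring.Mult.TCOptimised as Mult′
import Algebra.Solver.Ring
open import Algebra.Solver.Ring.AlmostCommutativeRing
  using (fromCommutativeRing; _-Raw-AlmostCommutative⟶_)
open import Data.Bool.Base using (Bool; true; false; not; if_then_else_)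
import Data.Bool.Properties as Bool
open import Data.Empty using (⊥; ⊥-elim)
open import Data.Fin.Base as Fin using (Fin; toℕ; inject₁)
open import Data.Fin.Induction using (<-weakInduction; <-weakInduction-startingFrom)
import Data.Fin.Permutation as Permutation
import Data.Fin.Properties as Fin
open import Data.Integer.Base as ℤ using (ℤ; +_; -[1+_])
import Data.Integer.Properties as ℤ
open import Data.List.Base using (List; []; _∷_; _++_)
open import Data.List.Membership.Propositional using (_∈_)
import Data.List.Membership.Propositional.Properties as ∈
open import Data.List.Relation.Unary.All as All using ([]; _∷_)
open import Data.List.Relation.Unary.AllPairs using (AllPairs; []; _∷_)
import Data.List.Relation.Unary.AllPairs.Properties as AllPairs
open import Data.List.Relation.Unary.Any using (here; there)
open import Data.Maybe.Base using (Maybe; just; nothing)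
open import Data.Nat.Base as ℕ using (ℕ; zero; suc)
import Data.Nat.Properties as ℕ
open import Data.Product.Base using (Σ-syntax; ∃-syntax; _×_; _,_; proj₁; proj₂)
open import Data.Sum.Base as ⊎ using (_⊎_; inj₁; inj₂; [_,_]′)
open import Effect.Monad using (RawMonad)
open import Function.Base using (_∘_)
open import Function.Bundles using (_⇔_; Equivalence; mk⇔)
open import Level using (_⊔_; 0ℓ)
open import Relation.Binary.Core using (Rel)
open import Relation.Binary.Definitions using (tri<; tri≈; tri>)
open import Relation.Binary.PropositionalEquality as ≡ using (_≡_; _≢_)
import Relation.Binary.Reasoning.Setoid as SetoidReasoning
open import Relation.Binary.Structures using (IsStrictPartialOrder)
open import Relation.Nullary using (¬_; yes; no; _×-dec_; _⊎-dec_)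
open import Relation.Nullary.Negation using (¬¬-Monad)

-- Polynomial identities, normalised with integer coefficients.

module IntegerCoefficients {c ℓ} (R : CommutativeRing c ℓ) where

  open CommutativeRing R
  open RingProperties ring
  open Mult semiring using (×-homo-+; ×1-homo-*)
  open Mult′ semiring using (×ᵤ≈×) renaming (_×_ to infixl 8 _·_)
  open Mult semiring using () renaming (_×_ to infixl 8 _·ᵤ_)
  open SetoidReasoning setoid

  -- With the optimised multiple, `0 · 1#` and `1 · 1#` reduce to `0#` and `1#`, so that solved
  -- identities contain these constants literally.
  fromℤ : ℤ → Carrier
  fromℤ (+ n)    = n · 1#
  fromℤ -[1+ n ] = - (suc n · 1#)

  private
    ×-+ : ∀ m n → (m ℕ.+ n) · 1# ≈ m · 1# + n · 1#
    ×-+ m n = begin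
      (m ℕ.+ n) · 1#       ≈⟨ ×ᵤ≈× (m ℕ.+ n) 1# ⟨
      (m ℕ.+ n) ·ᵤ 1#      ≈⟨ ×-homo-+ 1# m n ⟩
      m ·ᵤ 1# + n ·ᵤ 1#    ≈⟨ +-cong (×ᵤ≈× m 1#) (×ᵤ≈× n 1#) ⟩
      m · 1# + n · 1#      ∎

    ×-* : ∀ m n → (m ℕ.* n) · 1# ≈ (m · 1#) * (n · 1#)
    ×-* m n = begin
      (m ℕ.* n) · 1#          ≈⟨ ×ᵤ≈× (m ℕ.* n) 1# ⟨
      (m ℕ.* n) ·ᵤ 1#         ≈⟨ ×1-homo-* m n ⟩
      (m ·ᵤ 1#) * (n ·ᵤ 1#)   ≈⟨ *-cong (×ᵤ≈× m 1#) (×ᵤ≈× n 1#) ⟩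
      (m · 1#) * (n · 1#)     ∎

    ⊖-homo : ∀ m n → fromℤ (m ℤ.⊖ n) ≈ m · 1# - n · 1#
    ⊖-homo m zero = sym (trans (+-congˡ -0#≈0#) (+-identityʳ _))
    ⊖-homo zero (suc n) = sym (+-identityˡ _)
    ⊖-homo (suc m) (suc n) = begin
      fromℤ (suc m ℤ.⊖ suc n)                  ≡⟨ ≡.cong fromℤ (ℤ.[1+m]⊖[1+n]≡m⊖n m n) ⟩
      fromℤ (m ℤ.⊖ n)                          ≈⟨ ⊖-homo m n ⟩
      m · 1# - n · 1#                          ≈⟨ +-congˡ (+-identityˡ _) ⟨
      m · 1# + (0# - n · 1#)                   ≈⟨ +-congˡ (+-congʳ (-‿inverseʳ 1#)) ⟨
      m · 1# + (1# - 1# - n · 1#)              ≈⟨ +-congˡ (+-assoc _ _ _) ⟩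
      m · 1# + (1# + (- 1# - n · 1#))          ≈⟨ +-assoc _ _ _ ⟨
      m · 1# + 1# + (- 1# - n · 1#)            ≈⟨ +-cong (+-comm _ _) (-‿+-comm _ _) ⟩
      1# + m · 1# - (1# + n · 1#)              ≈⟨ +-cong (×-+ 1 m) (-‿cong (×-+ 1 n)) ⟨
      suc m · 1# - suc n · 1#                  ∎

    -‿homo : ∀ i → fromℤ (ℤ.- i) ≈ - fromℤ i
    -‿homo (+ zero)  = sym -0#≈0#
    -‿homo (+ suc n) = refl
    -‿homo -[1+ n ]  = sym (-‿involutive _)

    +-homo : ∀ i j → fromℤ (i ℤ.+ j) ≈ fromℤ i + fromℤ j
    +-homo (+ m)    (+ n)    = ×-+ m n
    +-homo (+ m)    -[1+ n ] = ⊖-homo m (suc n)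
    +-homo -[1+ m ] (+ n)    = trans (⊖-homo n (suc m)) (+-comm _ _)
    +-homo -[1+ m ] -[1+ n ] = begin
      - (suc (suc (m ℕ.+ n)) · 1#)       ≡⟨ ≡.cong (λ k → - (suc k · 1#)) (ℕ.+-suc m n) ⟨
      - ((suc m ℕ.+ suc n) · 1#)         ≈⟨ -‿cong (×-+ (suc m) (suc n)) ⟩
      - (suc m · 1# + suc n · 1#)        ≈⟨ -‿+-comm _ _ ⟨
      - (suc m · 1#) - suc n · 1#        ∎

    *-homo⁺ : ∀ m j → fromℤ (+ m ℤ.* j) ≈ m · 1# * fromℤ j
    *-homo⁺ m (+ n) = trans (reflexive (≡.cong fromℤ (≡.sym (ℤ.pos-* m n)))) (×-* m n)
    *-homo⁺ m -[1+ n ] = begin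
      fromℤ (+ m ℤ.* -[1+ n ])          ≡⟨ ≡.cong fromℤ (ℤ.neg-distribʳ-* (+ m) (+ suc n)) ⟨
      fromℤ (ℤ.- (+ m ℤ.* + suc n))     ≈⟨ -‿homo (+ m ℤ.* + suc n) ⟩
      - fromℤ (+ m ℤ.* + suc n)         ≈⟨ -‿cong (*-homo⁺ m (+ suc n)) ⟩
      - (m · 1# * (suc n · 1#))         ≈⟨ -‿distribʳ-* _ _ ⟩
      m · 1# * - (suc n · 1#)           ∎

    *-homo : ∀ i j → fromℤ (i ℤ.* j) ≈ fromℤ i * fromℤ j
    *-homo (+ m)    j = *-homo⁺ m j
    *-homo -[1+ m ] j = begin
      fromℤ (-[1+ m ] ℤ.* j)           ≡⟨ ≡.cong fromℤ (ℤ.neg-distribˡ-* (+ suc m) j) ⟨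
      fromℤ (ℤ.- (+ suc m ℤ.* j))      ≈⟨ -‿homo (+ suc m ℤ.* j) ⟩
      - fromℤ (+ suc m ℤ.* j)          ≈⟨ -‿cong (*-homo⁺ (suc m) j) ⟩
      - (suc m · 1# * fromℤ j)         ≈⟨ -‿distribˡ-* _ _ ⟩
      - (suc m · 1#) * fromℤ j         ∎

    morphism : ℤ.+-*-rawRing -Raw-AlmostCommutative⟶ fromCommutativeRing R
    morphism = record
      { ⟦_⟧    = fromℤ
      ; +-homo = +-homo
      ; *-homo = *-homo
      ; -‿homo = -‿homo
      ; 0-homo = refl
      ; 1-homo = refl
      }

    _≟_ : ∀ i j → Maybe (fromℤ i ≈ fromℤ j)
    i ≟ j with i ℤ.≟ j
    ... | yes i≡j = just (reflexive (≡.cong fromℤ i≡j))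
    ... | no  _   = nothing

  open Algebra.Solver.Ring ℤ.+-*-rawRing (fromCommutativeRing R) morphism _≟_ public
    using (Polynomial; solve; con; _:+_; _:*_; _:-_; :-_; _:=_)

-- Order and inverses without decidable comparison.

module RealFieldProperties {c ℓ₁ ℓ₂ ℓ₃} (R : RealField c ℓ₁ ℓ₂ ℓ₃) where

  open RealField R
  open Drawings R using (UnitInterval)
  open CommutativeRing commutativeRing public
    using (refl; sym; trans; reflexive; setoid; semiring;
           +-cong; +-congˡ; +-congʳ; *-cong; *-congˡ; *-congʳ; -‿cong;
           +-comm; +-identityˡ; +-identityʳ; -‿inverseʳ;
           *-assoc; *-comm; *-identityˡ; *-identityʳ; zeroˡ; zeroʳ)
  open IntegerCoefficients commutativeRing public
  open HeytingField heytingField using (#⇒invertible; invertible⇒#; #-cotrans; tight)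
  open HCRProperties heytingCommutativeRing using (x-0≈x)
  open IsStrictPartialOrder <-isStrictPartialOrder public
    using () renaming (trans to <-trans; irrefl to <-irrefl; asym to <-asym;
                       <-respˡ-≈ to <-respˡ; <-respʳ-≈ to <-respʳ)

  :0 :1 :2 : ∀ {n} → Polynomial n
  :0 = con (+ 0)
  :1 = con (+ 1)
  :2 = :1 :+ :1

  2# : Carrier
  2# = 1# + 1#

  opaque
    <⇒0<- : ∀ {x y} → x < y → 0# < y - x
    <⇒0<- {x} x<y = <-respˡ (-‿inverseʳ x) (+-monoˡ-< (- x) x<y)

    <-by : ∀ {x y e} → y - x ≈ e → 0# < e → x < y
    <-by {x} {y} y-x≈e 0<e =
      <-respˡ (+-identityˡ x)
        (<-respʳ (trans (+-congʳ (sym y-x≈e)) (solve 2 (λ x y → (y :- x) :+ x := y) refl x y))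
          (+-monoˡ-< x 0<e))

    +-pos : ∀ {x y} → 0# < x → 0# < y → 0# < x + y
    +-pos {x} {y} 0<x 0<y = <-trans 0<y (<-respˡ (+-identityˡ y) (+-monoˡ-< y 0<x))

    -- The substitute for trichotomy. Cotransitivity of apartness yields `x # y` or `y # z`; if the
    -- resulting inequality has the wrong direction, `x < z` turns it into the other alternative.
    <-cotrans : ∀ {x z} → x < z → ∀ y → x < y ⊎ y < z
    <-cotrans {x} {z} x<z y = [ left , right ]′ (#-cotrans (Equivalence.from #⇔<⊎> (inj₁ x<z)) y)
      where
      left : x # y → x < y ⊎ y < z
      left x#y with Equivalence.to #⇔<⊎> x#y
      ... | inj₁ x<y = inj₁ x<y
      ... | inj₂ y<x = inj₂ (<-trans y<x x<z)
      right : y # z → x < y ⊎ y < z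
      right y#z with Equivalence.to #⇔<⊎> y#z
      ... | inj₁ y<z = inj₂ y<z
      ... | inj₂ z<y = inj₁ (<-trans x<z z<y)

    <⇒≤ : ∀ {x y} → x < y → x ≤ y
    <⇒≤ x<y y<x = <-asym x<y y<x

    ≈⇒≤ : ∀ {x y} → x ≈ y → x ≤ y
    ≈⇒≤ x≈y y<x = <-irrefl (sym x≈y) y<x

    ≤-refl : ∀ {x} → x ≤ x
    ≤-refl = ≈⇒≤ refl

    ≤-antisym : ∀ {x y} → x ≤ y → y ≤ x → x ≈ y
    ≤-antisym {x} {y} x≤y y≤x =
      proj₁ (tight x y) λ x#y → [ y≤x , x≤y ]′ (Equivalence.to #⇔<⊎> x#y)

    ≤-trans : ∀ {x y z} → x ≤ y → y ≤ z → x ≤ z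
    ≤-trans {y = y} x≤y y≤z z<x = [ y≤z , x≤y ]′ (<-cotrans z<x y)

    <-≤-trans : ∀ {x y z} → x < y → y ≤ z → x < z
    <-≤-trans {z = z} x<y y≤z with <-cotrans x<y z
    ... | inj₁ x<z = x<z
    ... | inj₂ z<y = ⊥-elim (y≤z z<y)

    ≤-<-trans : ∀ {x y z} → x ≤ y → y < z → x < z
    ≤-<-trans {x} x≤y y<z with <-cotrans y<z x
    ... | inj₁ y<x = ⊥-elim (x≤y y<x)
    ... | inj₂ x<z = x<z

    ≤-respʳ : ∀ {x y z} → y ≈ z → x ≤ y → x ≤ z
    ≤-respʳ y≈z x≤y = x≤y ∘ <-respˡ (sym y≈z)

    ≤-respˡ : ∀ {x y z} → y ≈ z → y ≤ x → z ≤ x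
    ≤-respˡ y≈z y≤x = y≤x ∘ <-respʳ (sym y≈z)

    -- Since `≤` is a negation, proofs of `≤` have the goal `⊥` and may split into these two cases.
    ≤⇒¬¬<⊎≈ : ∀ {x y} → x ≤ y → ¬ ¬ (x < y ⊎ x ≈ y)
    ≤⇒¬¬<⊎≈ x≤y k = k (inj₂ (≤-antisym x≤y (k ∘ inj₁)))

    ≤-by : ∀ {x y e} → y - x ≈ e → 0# ≤ e → x ≤ y
    ≤-by {x} {y} y-x≈e 0≤e y<x =
      0≤e (<-by (trans (+-congˡ (-‿cong (sym y-x≈e)))
                       (solve 2 (λ x y → :0 :- (y :- x) := x :- y) refl x y))
                (<⇒0<- y<x))

    ≤⇒0≤- : ∀ {x y} → x ≤ y → 0# ≤ y - x
    ≤⇒0≤- {x} {y} x≤y y-x<0 =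
      x≤y (<-by (solve 2 (λ x y → x :- y := :0 :- (y :- x)) refl x y) (<⇒0<- y-x<0))

    +-nonNeg : ∀ {x y} → 0# ≤ x → 0# ≤ y → 0# ≤ x + y
    +-nonNeg {x} {y} 0≤x 0≤y x+y<0 with <-cotrans x+y<0 y
    ... | inj₁ x+y<y = 0≤x (<-by (solve 2 (λ x y → :0 :- x := y :- (x :+ y)) refl x y) (<⇒0<- x+y<y))
    ... | inj₂ y<0   = 0≤y y<0

    *-nonNeg : ∀ {x y} → 0# ≤ x → 0# ≤ y → 0# ≤ x * y
    *-nonNeg {x} {y} 0≤x 0≤y xy<0 = ≤⇒¬¬<⊎≈ 0≤x λ
      { (inj₂ 0≈x) → <-irrefl (trans (*-congʳ (sym 0≈x)) (zeroˡ y)) xy<0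
      ; (inj₁ 0<x) → ≤⇒¬¬<⊎≈ 0≤y λ
        { (inj₂ 0≈y) → <-irrefl (trans (*-congˡ (sym 0≈y)) (zeroʳ x)) xy<0
        ; (inj₁ 0<y) → <-asym xy<0 (*-pos 0<x 0<y)
        }
      }

    +-posˡ : ∀ {x y} → 0# < x → 0# ≤ y → 0# < x + y
    +-posˡ {x} {y} 0<x 0≤y = ≤-<-trans 0≤y (<-respˡ (+-identityˡ y) (+-monoˡ-< y 0<x))

    +-posʳ : ∀ {x y} → 0# ≤ x → 0# < y → 0# < x + y
    +-posʳ 0≤x 0<y = <-respʳ (+-comm _ _) (+-posˡ 0<y 0≤x)

    neg-pos : ∀ {x} → x < 0# → 0# < - x
    neg-pos x<0 = <-respʳ (+-identityˡ _) (<⇒0<- x<0)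

    pos-neg : ∀ {x} → 0# < - x → x < 0#
    pos-neg 0<-x = <-by (+-identityˡ _) 0<-x

    *-monoʳ-≤ : ∀ {x y z} → 0# ≤ z → x ≤ y → x * z ≤ y * z
    *-monoʳ-≤ {x} {y} {z} 0≤z x≤y =
      ≤-by (solve 3 (λ x y z → y :* z :- x :* z := (y :- x) :* z) refl x y z) (*-nonNeg (≤⇒0≤- x≤y) 0≤z)

    inverse : ∀ {x} → 0# < x → ∃[ w ] 0# < w × x * w ≈ 1#
    inverse {x} 0<x with #⇒invertible (Equivalence.from #⇔<⊎> (inj₂ 0<x))
    ... | w , w[x-0]≈1 , [x-0]w≈1 = w , 0<w , xw≈1
      where
      xw≈1 : x * w ≈ 1#
      xw≈1 = trans (*-congʳ (sym (x-0≈x x))) [x-0]w≈1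
      w#0 : w # 0#
      w#0 = invertible⇒# (x , trans (*-congˡ (x-0≈x w)) xw≈1
                            , trans (*-congʳ (x-0≈x w)) (trans (*-comm w x) xw≈1))
      0<w : 0# < w
      0<w with Equivalence.to #⇔<⊎> w#0
      ... | inj₂ 0<w = 0<w
      ... | inj₁ w<0 = ⊥-elim (<-asym 0<1 (pos-neg (<-respʳ x[-w]≈-1 (*-pos 0<x (neg-pos w<0)))))
        where
        x[-w]≈-1 : x * - w ≈ - 1#
        x[-w]≈-1 = trans (solve 2 (λ x w → x :* :- w := :- (x :* w)) refl x w) (-‿cong xw≈1)

    *-cancelˡ-pos : ∀ {x y} → 0# < x → 0# < x * y → 0# < y
    *-cancelˡ-pos {x} {y} 0<x 0<xy with inverse 0<x
    ... | w , 0<w , xw≈1 = <-respʳ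
      (trans (solve 3 (λ x y w → x :* y :* w := x :* w :* y) refl x y w)
             (trans (*-congʳ xw≈1) (*-identityˡ y)))
      (*-pos 0<xy 0<w)

    *-cancelˡ-nonNeg : ∀ {x y} → 0# < x → 0# ≤ x * y → 0# ≤ y
    *-cancelˡ-nonNeg {x} {y} 0<x 0≤xy y<0 =
      0≤xy (pos-neg (<-respʳ (solve 2 (λ x y → x :* :- y := :- (x :* y)) refl x y)
                             (*-pos 0<x (neg-pos y<0))))

    *-cancelˡ-≈0 : ∀ {x y} → 0# < x → x * y ≈ 0# → y ≈ 0#
    *-cancelˡ-≈0 {x} {y} 0<x xy≈0 with inverse 0<x
    ... | w , _ , xw≈1 = trans
      (trans (sym (*-identityˡ y)) (*-congʳ (sym xw≈1)))
      (trans (solve 3 (λ x y w → x :* w :* y := x :* y :* w) refl x y w)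
             (trans (*-congʳ xy≈0) (zeroˡ w)))

    0≤1 : 0# ≤ 1#
    0≤1 = <⇒≤ 0<1

    0<2 : 0# < 2#
    0<2 = +-pos 0<1 0<1

    square-nonNeg : ∀ x → 0# ≤ x * x
    square-nonNeg x x²<0 = <-irrefl (trans (*-congʳ x≈0) (zeroˡ x)) x²<0
      where
      x≈0 : x ≈ 0#
      x≈0 = ≤-antisym
        (λ 0<x → <-asym x²<0 (*-pos 0<x 0<x))
        (λ x<0 → <-asym x²<0 (<-respʳ (solve 1 (λ x → :- x :* :- x := x :* x) refl x)
                                      (*-pos (neg-pos x<0) (neg-pos x<0))))

    square-mono-≤ : ∀ {x y} → 0# ≤ x → x ≤ y → x * x ≤ y * y
    square-mono-≤ {x} {y} 0≤x x≤y =
      ≤-by (solve 2 (λ x y → y :* y :- x :* x := (y :- x) :* (y :+ x)) refl x y)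
           (*-nonNeg (≤⇒0≤- x≤y) (+-nonNeg (≤-trans 0≤x x≤y) 0≤x))

    square-mono-< : ∀ {x y} → 0# ≤ x → x < y → x * x < y * y
    square-mono-< {x} {y} 0≤x x<y =
      <-by (solve 2 (λ x y → y :* y :- x :* x := (y :- x) :* (y :+ x)) refl x y)
           (*-pos (<⇒0<- x<y) (+-posˡ (≤-<-trans 0≤x x<y) 0≤x))

    square-cancel-≤ : ∀ {x y} → 0# ≤ y → x * x ≤ y * y → x ≤ y
    square-cancel-≤ 0≤y x²≤y² y<x = x²≤y² (square-mono-< 0≤y y<x)

  -- Square roots by approximation on grids, and zeros of quadratics.

  fromNat-+ : ∀ m n → fromNat (m ℕ.+ n) ≈ fromNat m + fromNat n
  fromNat-+ = Mult.×-homo-+ semiring 1#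

  opaque
    0≤fromNat : ∀ n → 0# ≤ fromNat n
    0≤fromNat zero    = ≤-refl
    0≤fromNat (suc n) = +-nonNeg 0≤1 (0≤fromNat n)

    0<fromNat-suc : ∀ n → 0# < fromNat (suc n)
    0<fromNat-suc n = +-posˡ 0<1 (0≤fromNat n)

    fromNat-mono-≤ : ∀ {m n} → m ℕ.≤ n → fromNat m ≤ fromNat n
    fromNat-mono-≤ {n = n} ℕ.z≤n = 0≤fromNat n
    fromNat-mono-≤ (ℕ.s≤s {m} {n} m≤n) =
      ≤-by (solve 2 (λ x y → :1 :+ y :- (:1 :+ x) := y :- x) refl (fromNat m) (fromNat n))
           (≤⇒0≤- (fromNat-mono-≤ m≤n))

  opaque
    -- The mesh 1 / (n + 1) of the n-th grid; not the δ = a × c of the geometry.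
    δ : ℕ → Carrier
    δ n = proj₁ (inverse (0<fromNat-suc n))

    0<δ : ∀ n → 0# < δ n
    0<δ n = proj₁ (proj₂ (inverse (0<fromNat-suc n)))

    fromNat-suc*δ : ∀ n → fromNat (suc n) * δ n ≈ 1#
    fromNat-suc*δ n = proj₂ (proj₂ (inverse (0<fromNat-suc n)))

  δ≤1 : ∀ n → δ n ≤ 1#
  δ≤1 n = ≤-by (trans (+-congʳ (sym (fromNat-suc*δ n)))
                      (solve 2 (λ x d → (:1 :+ x) :* d :- d := x :* d) refl (fromNat n) (δ n)))
               (*-nonNeg (0≤fromNat n) (<⇒≤ (0<δ n)))

  opaque
    δ-small : ∀ c {ε} → 0# < ε → ∃[ N ] (∀ n → N ℕ.≤ n → c * δ n < ε)
    δ-small c {ε} 0<ε with inverse 0<ε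
    ... | w , 0<w , εw≈1 with archimedean (c * w)
    ...   | N , cw<N = N , λ n N≤n →
      <-by (begin
        ε - c * δ n
          ≈⟨ +-cong (sym (*-identityʳ ε)) (-‿cong (sym (*-identityʳ _))) ⟩
        ε * 1# - c * δ n * 1#
          ≈⟨ +-cong (*-congˡ (sym (fromNat-suc*δ n))) (-‿cong (*-congˡ (sym εw≈1))) ⟩
        ε * (fromNat (suc n) * δ n) - c * δ n * (ε * w)
          ≈⟨ solve 5 (λ ε f d c w →
               ε :* (f :* d) :- c :* d :* (ε :* w) := (f :- c :* w) :* (ε :* d)) refl
               ε (fromNat (suc n)) (δ n) c w ⟩
        (fromNat (suc n) - c * w) * (ε * δ n) ∎)
        (*-pos (<⇒0<- (<-≤-trans cw<N (fromNat-mono-≤ (ℕ.m≤n⇒m≤1+n N≤n)))) (*-pos 0<ε (0<δ n)))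
      where open SetoidReasoning setoid

  ≤-infinitesimal : ∀ {x c} → (∀ n → x ≤ c * δ n) → x ≤ 0#
  ≤-infinitesimal {x} {c} x≤cδ 0<x with δ-small c 0<x
  ... | N , cδ<x = x≤cδ N (cδ<x N ℕ.≤-refl)

  private
    grid : Carrier → ℕ → Carrier
    grid δ k = fromNat k * δ

    grid-nonNeg : ∀ {δ} → 0# < δ → ∀ k → 0# ≤ grid δ k
    grid-nonNeg 0<δ k = *-nonNeg (0≤fromNat k) (<⇒≤ 0<δ)

    grid-step : ∀ {δ} → 0# < δ → ∀ k → grid δ k < grid δ (suc k)
    grid-step {δ} 0<δ k =
      <-by (solve 2 (λ f d → (:1 :+ f) :* d :- f :* d := d) refl (fromNat k) δ) 0<δ

    opaque
      -- A downward search from `K`. Only overlapping alternatives can be told apart, by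
      -- `<-cotrans`, so the bracket is two meshes wide instead of one.
      bracket : ∀ {δ d} → 0# < δ → 0# ≤ d → ∀ K → d ≤ grid δ (1 ℕ.+ K) * grid δ (1 ℕ.+ K) →
        ∃[ k ] grid δ k * grid δ k ≤ d × d ≤ grid δ (2 ℕ.+ k) * grid δ (2 ℕ.+ k)
      bracket {δ} 0<δ 0≤d zero d≤ =
        0 , ≤-respˡ (sym (solve 1 (λ e → :0 :* e :* (:0 :* e) := :0) refl δ)) 0≤d
          , ≤-trans d≤ (square-mono-≤ (grid-nonNeg 0<δ 1) (<⇒≤ (grid-step 0<δ 1)))
      bracket {δ} {d} 0<δ 0≤d (suc K) d≤
        with <-cotrans (square-mono-< (grid-nonNeg 0<δ K) (grid-step 0<δ K)) d
      ... | inj₁ <d = K , <⇒≤ <d , d≤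
      ... | inj₂ d< = bracket 0<δ 0≤d K (<⇒≤ d<)

    opaque
      -- The search may start at any grid point above d + 1, since (d + 1)² ≥ d.
      bound : ∀ {d} → 0# ≤ d → ∀ n → ∃[ K ] d ≤ grid (δ n) (1 ℕ.+ K) * grid (δ n) (1 ℕ.+ K)
      bound {d} 0≤d n with archimedean ((d + 1#) * fromNat (suc n))
      ... | K , d+1<K = K , ≤-trans d≤[d+1]² (square-mono-≤ 0≤d+1 d+1≤)
        where
        0≤d+1 : 0# ≤ d + 1#
        0≤d+1 = +-nonNeg 0≤d 0≤1
        d≤[d+1]² : d ≤ (d + 1#) * (d + 1#)
        d≤[d+1]² = ≤-by (solve 1 (λ d → (d :+ :1) :* (d :+ :1) :- d := d :* d :+ d :+ :1) refl d)
                        (+-nonNeg (+-nonNeg (*-nonNeg 0≤d 0≤d) 0≤d) 0≤1)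
        d+1≤ : d + 1# ≤ grid (δ n) (1 ℕ.+ K)
        d+1≤ = ≤-trans (≤-respˡ (trans (*-assoc _ _ _) (trans (*-congˡ (fromNat-suc*δ n)) (*-identityʳ _)))
                                (*-monoʳ-≤ (<⇒≤ (0<δ n)) (<⇒≤ d+1<K)))
                       (<⇒≤ (grid-step (0<δ n) K))

    module Approximation {d} {a b : ℕ → Carrier} (0≤a : ∀ n → 0# ≤ a n)
      (a²≤d : ∀ n → a n * a n ≤ d) (d≤b² : ∀ n → d ≤ b n * b n)
      (b≈a+2δ : ∀ n → b n ≈ a n + 2# * δ n) where

      0≤b : ∀ n → 0# ≤ b n
      0≤b n = ≤-respʳ (sym (b≈a+2δ n)) (+-nonNeg (0≤a n) (<⇒≤ (*-pos 0<2 (0<δ n))))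

      -- `d` separates the two squares. As `b n` exceeds `a n` by only `2# * δ n`, this is what
      -- makes `a` a Cauchy sequence.
      a≤b : ∀ m n → a m ≤ b n
      a≤b m n = square-cancel-≤ (0≤b n) (≤-trans (a²≤d m) (d≤b² n))

      a-a≤2δ : ∀ m n → a m - a n ≤ 2# * δ n
      a-a≤2δ m n =
        ≤-by (trans (solve 3 (λ x y e → e :- (x :- y) := y :+ e :- x) refl (a m) (a n) (2# * δ n))
                    (+-congʳ (sym (b≈a+2δ n))))
             (≤⇒0≤- (a≤b m n))

      cauchy : IsCauchy a
      cauchy ε 0<ε with δ-small 2# 0<ε
      ... | N , 2δ<ε = N , λ m n N≤m N≤n →
        ≤-<-trans (a-a≤2δ m n) (2δ<ε n N≤n) , ≤-<-trans (a-a≤2δ n m) (2δ<ε m N≤m)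

      module Limit {√} (lim : a ConvergesTo √) where

        √≤b : ∀ n → √ ≤ b n
        √≤b n b<√ with lim (√ - b n) (<⇒0<- b<√)
        ... | M , close = a≤b M n
          (<-by (solve 3 (λ s b x → x :- b := (s :- b) :- (s :- x)) refl √ (b n) (a M))
                (<⇒0<- (proj₂ (close M ℕ.≤-refl))))

        a≤√ : ∀ n → a n ≤ √
        a≤√ n √<a = a≤b n M (<-respˡ (sym (b≈a+2δ M)) (<-by a-a-2δ≈ (+-pos (<⇒0<- a-√<h) (<⇒0<- 2δ<h))))
          where
          half : ∃[ w ] 0# < w × 2# * w ≈ 1#
          half = inverse 0<2
          -- Half of the gap between √ and `a n` pays for the distance from `a M` to √, the other
          -- half for the width `2# * δ M`; hence `b M < a n`.
          h : Carrier
          h = (a n - √) * proj₁ half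
          0<h : 0# < h
          0<h = *-pos (<⇒0<- √<a) (proj₁ (proj₂ half))
          M₁ M₂ M : ℕ
          M₁ = proj₁ (lim h 0<h)
          M₂ = proj₁ (δ-small 2# 0<h)
          M  = M₁ ℕ.⊔ M₂
          a-√<h : a M - √ < h
          a-√<h = proj₁ (proj₂ (lim h 0<h) M (ℕ.m≤m⊔n M₁ M₂))
          2δ<h : 2# * δ M < h
          2δ<h = proj₂ (δ-small 2# 0<h) M (ℕ.m≤n⊔m M₁ M₂)
          a-a-2δ≈ : a n - (a M + 2# * δ M) ≈ (h - (a M - √)) + (h - 2# * δ M)
          a-a-2δ≈ = begin
            a n - (a M + 2# * δ M)
              ≈⟨ solve 4 (λ x y e s → x :- (y :+ e) := (x :- s) :* :1 :- (y :- s) :- e) refl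
                   (a n) (a M) (2# * δ M) √ ⟩
            (a n - √) * 1# - (a M - √) - 2# * δ M
              ≈⟨ +-congʳ (+-congʳ (*-congˡ (proj₂ (proj₂ half)))) ⟨
            (a n - √) * (2# * proj₁ half) - (a M - √) - 2# * δ M
              ≈⟨ solve 4 (λ x w y e →
                   x :* (:2 :* w) :- y :- e := (x :* w :- y) :+ (x :* w :- e)) refl
                   (a n - √) (proj₁ half) (a M - √) (2# * δ M) ⟩
            (h - (a M - √)) + (h - 2# * δ M) ∎
            where open SetoidReasoning setoid

        b²-a²≤ : ∀ n → b n * b n - a n * a n ≤ (2# * 2# * (√ + 1#)) * δ n
        b²-a²≤ n =
          ≤-by (trans (+-congˡ (-‿cong (+-congʳ (*-cong (b≈a+2δ n) (b≈a+2δ n)))))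
                      (solve 3 (λ s x e →
                         :2 :* :2 :* (s :+ :1) :* e :- ((x :+ :2 :* e) :* (x :+ :2 :* e) :- x :* x)
                         := :2 :* :2 :* ((s :- x) :+ (:1 :- e)) :* e) refl √ (a n) (δ n)))
               (*-nonNeg (*-nonNeg (<⇒≤ (*-pos 0<2 0<2)) (+-nonNeg (≤⇒0≤- (a≤√ n)) (≤⇒0≤- (δ≤1 n))))
                         (<⇒≤ (0<δ n)))

        -- Both √ * √ and d lie between the squares of `a n` and `b n`, whose distance tends to 0;
        -- the two inequalities between them are instances of this.
        difference : ∀ {x y} → (∀ n → x ≤ b n * b n) → (∀ n → a n * a n ≤ y) → x ≤ y
        difference {x} {y} x≤b² a²≤y y<x =
          ≤-infinitesimal (λ n → ≤-trans (x-y≤ n) (b²-a²≤ n)) (<⇒0<- y<x)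
          where
          x-y≤ : ∀ n → x - y ≤ b n * b n - a n * a n
          x-y≤ n = ≤-by (solve 4 (λ x y b a → b :- a :- (x :- y) := (b :- x) :+ (y :- a)) refl
                           x y (b n * b n) (a n * a n))
                        (+-nonNeg (≤⇒0≤- (x≤b² n)) (≤⇒0≤- (a²≤y n)))

        0≤√ : 0# ≤ √
        0≤√ = ≤-trans (0≤a 0) (a≤√ 0)

        √*√≈d : √ * √ ≈ d
        √*√≈d = ≤-antisym
          (difference (λ n → square-mono-≤ 0≤√ (√≤b n)) a²≤d)
          (difference d≤b² (λ n → square-mono-≤ (0≤a n) (a≤√ n)))

  opaque
    square-root : ∀ {d} → 0# ≤ d → ∃[ s ] 0# ≤ s × s * s ≈ d
    square-root {d} 0≤d =
      let √ , lim = complete a cauchy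
          open Limit lim
      in √ , 0≤√ , √*√≈d
      where
      bracketed : ∀ n →
        ∃[ k ] grid (δ n) k * grid (δ n) k ≤ d × d ≤ grid (δ n) (2 ℕ.+ k) * grid (δ n) (2 ℕ.+ k)
      bracketed n = let K , d≤ = bound 0≤d n in bracket (0<δ n) 0≤d K d≤
      a b : ℕ → Carrier
      a n = grid (δ n) (proj₁ (bracketed n))
      b n = grid (δ n) (2 ℕ.+ proj₁ (bracketed n))
      open Approximation {d} {a} {b}
        (λ n → grid-nonNeg (0<δ n) (proj₁ (bracketed n)))
        (λ n → proj₁ (proj₂ (bracketed n)))
        (λ n → proj₂ (proj₂ (bracketed n)))
        (λ n → solve 2 (λ f e → (:1 :+ (:1 :+ f)) :* e := f :* e :+ :2 :* e) refl
                 (fromNat (proj₁ (bracketed n))) (δ n))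

  opaque
    -- In the ratio u = (1 - t) / t the equation reads N u² = M u + C.
    quadratic-root : ∀ {N M C} → 0# < N → 0# ≤ C →
      ∃[ t ] UnitInterval t ×
        (1# - t) * (1# - t) * (- N) + (1# - t) * t * M + t * t * C ≈ 0#
    quadratic-root {N} {M} {C} 0<N 0≤C = t , (<⇒≤ 0<t , t≤1) , root
      where
      open SetoidReasoning setoid
      -- The discriminant is at least M², so the root u taken with the plus sign is nonnegative, and
      -- t = 1 / (1 + u) lies in the unit interval.
      sq : ∃[ s ] 0# ≤ s × s * s ≈ M * M + 2# * 2# * (N * C)
      sq = square-root (+-nonNeg (square-nonNeg M) (*-nonNeg (<⇒≤ (*-pos 0<2 0<2)) (*-nonNeg (<⇒≤ 0<N) 0≤C)))
      √ : Carrier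
      √ = proj₁ sq
      0≤√ : 0# ≤ √
      0≤√ = proj₁ (proj₂ sq)
      √*√≈d : √ * √ ≈ M * M + 2# * 2# * (N * C)
      √*√≈d = proj₂ (proj₂ sq)
      0<2N : 0# < 2# * N
      0<2N = *-pos 0<2 0<N
      w : Carrier
      w = proj₁ (inverse 0<2N)
      0≤M+√ : 0# ≤ M + √
      0≤M+√ M+√<0 = M²≤√² (<-respʳ (solve 1 (λ x → :- x :* :- x := x :* x) refl M) (square-mono-< 0≤√ √<-M))
        where
        √<-M : √ < - M
        √<-M = <-by (solve 2 (λ m s → :- m :- s := :0 :- (m :+ s)) refl M √) (<⇒0<- M+√<0)
        M²≤√² : M * M ≤ √ * √
        M²≤√² = ≤-by (trans (+-congʳ √*√≈d)
                            (solve 2 (λ m e → m :+ e :- m := e) refl (M * M) (2# * 2# * (N * C))))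
                     (*-nonNeg (<⇒≤ (*-pos 0<2 0<2)) (*-nonNeg (<⇒≤ 0<N) 0≤C))
      u : Carrier
      u = (M + √) * w
      0≤u : 0# ≤ u
      0≤u = *-nonNeg 0≤M+√ (<⇒≤ (proj₁ (proj₂ (inverse 0<2N))))
      2Nu≈M+√ : 2# * N * u ≈ M + √
      2Nu≈M+√ = begin
        2# * N * ((M + √) * w)   ≈⟨ solve 3 (λ n e w → n :* (e :* w) := n :* w :* e) refl (2# * N) (M + √) w ⟩
        2# * N * w * (M + √)     ≈⟨ *-congʳ (proj₂ (proj₂ (inverse 0<2N))) ⟩
        1# * (M + √)             ≈⟨ *-identityˡ _ ⟩
        M + √                    ∎
      u-equation : N * (u * u) - M * u - C ≈ 0#
      u-equation = *-cancelˡ-≈0 (*-pos (*-pos 0<2 0<2) 0<N) (begin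
        2# * 2# * N * (N * (u * u) - M * u - C)
          ≈⟨ solve 4 (λ n u m c → :2 :* :2 :* n :* (n :* (u :* u) :- m :* u :- c)
                              := (:2 :* n :* u :- m) :* (:2 :* n :* u :- m)
                                :- (m :* m :+ :2 :* :2 :* (n :* c)))
                     refl N u M C ⟩
        (2# * N * u - M) * (2# * N * u - M) - (M * M + 2# * 2# * (N * C))
          ≈⟨ +-cong (*-cong (+-congʳ 2Nu≈M+√) (+-congʳ 2Nu≈M+√)) (-‿cong (sym √*√≈d)) ⟩
        (M + √ - M) * (M + √ - M) - √ * √
          ≈⟨ solve 2 (λ m s → (m :+ s :- m) :* (m :+ s :- m) :- s :* s := :0) refl M √ ⟩
        0# ∎)
      0<1+u : 0# < 1# + u
      0<1+u = +-posˡ 0<1 0≤u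
      t : Carrier
      t = proj₁ (inverse 0<1+u)
      0<t : 0# < t
      0<t = proj₁ (proj₂ (inverse 0<1+u))
      1-t≈ut : 1# - t ≈ u * t
      1-t≈ut = trans (+-congʳ (sym (proj₂ (proj₂ (inverse 0<1+u)))))
                     (solve 2 (λ u t → (:1 :+ u) :* t :- t := u :* t) refl u t)
      t≤1 : t ≤ 1#
      t≤1 = ≤-by 1-t≈ut (*-nonNeg 0≤u (<⇒≤ 0<t))
      root : (1# - t) * (1# - t) * (- N) + (1# - t) * t * M + t * t * C ≈ 0#
      root = begin
        (1# - t) * (1# - t) * (- N) + (1# - t) * t * M + t * t * C
          ≈⟨ +-congʳ (+-cong (*-congʳ (*-cong 1-t≈ut 1-t≈ut)) (*-congʳ (*-congʳ 1-t≈ut))) ⟩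
        u * t * (u * t) * (- N) + u * t * t * M + t * t * C
          ≈⟨ solve 5 (λ u t n m c → u :* t :* (u :* t) :* (:- n) :+ u :* t :* t :* m :+ t :* t :* c
                                 := :- (t :* t :* (n :* (u :* u) :- m :* u :- c))) refl u t N M C ⟩
        - (t * t * (N * (u * u) - M * u - C))
          ≈⟨ -‿cong (trans (*-congˡ u-equation) (zeroʳ _)) ⟩
        - 0#
          ≈⟨ solve 0 (:- :0 := :0) refl ⟩
        0# ∎

-- Three consecutive edges: orientations, heights and crossings.

module PlaneGeometry {c ℓ₁ ℓ₂ ℓ₃} (R : RealField c ℓ₁ ℓ₂ ℓ₃) where

  open RealField R
  open Drawings R
  open RealFieldProperties R

  -- Positive iff p, q, r form a left turn.
  orient : Point → Point → Point → Carrier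
  orient p q r = (xOf q - xOf p) * (yOf r - yOf p) - (yOf q - yOf p) * (xOf r - xOf p)

  Clockwise : Point → Point → Point → Set ℓ₃
  Clockwise p q r = 0# < - orient p q r

  height : Carrier → Point → Point → Carrier
  height σ p q = σ * (yOf q - yOf p)

  Disjoint : (p q r s : Point) → Set (ℓ₁ ⊔ c ⊔ ℓ₃)
  Disjoint p q r s = ∀ {t u} → UnitInterval t → UnitInterval u → ¬ (lerp t p q ≈ₚ lerp u r s)

  private
    :orient : ∀ {n} (px py qx qy rx ry : Polynomial n) → Polynomial n
    :orient px py qx qy rx ry = (qx :- px) :* (ry :- py) :- (qy :- py) :* (rx :- px)

  opaque
    orient-cyclic : ∀ p q r → orient p q r ≈ orient q r p
    orient-cyclic (px , py) (qx , qy) (rx , ry) =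
      solve 6 (λ px py qx qy rx ry → :orient px py qx qy rx ry := :orient qx qy rx ry px py) refl
        px py qx qy rx ry

    -- Both sides are δ = a × c, as (δ - α) + α and as (δ - β) + β.
    orient-exchange : ∀ p₀ p₁ p₂ p₃ →
      orient p₀ p₁ p₃ + - orient p₀ p₁ p₂ ≈ orient p₂ p₃ p₀ + - orient p₁ p₂ p₃
    orient-exchange (x₀ , y₀) (x₁ , y₁) (x₂ , y₂) (x₃ , y₃) =
      solve 8 (λ x₀ y₀ x₁ y₁ x₂ y₂ x₃ y₃ →
        :orient x₀ y₀ x₁ y₁ x₃ y₃ :+ :- :orient x₀ y₀ x₁ y₁ x₂ y₂ :=
        :orient x₂ y₂ x₃ y₃ x₀ y₀ :+ :- :orient x₁ y₁ x₂ y₂ x₃ y₃) refl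
        x₀ y₀ x₁ y₁ x₂ y₂ x₃ y₃

    -- The affine dependence of four points in the plane, with signed triangle areas as
    -- coefficients, arranged so that each side belongs to one of the two outer edges.
    barycentric-x : ∀ p₀ p₁ p₂ p₃ →
      - orient p₁ p₂ p₃ * xOf p₀ + orient p₂ p₃ p₀ * xOf p₁ ≈
      orient p₀ p₁ p₃ * xOf p₂ + - orient p₀ p₁ p₂ * xOf p₃
    barycentric-x (x₀ , y₀) (x₁ , y₁) (x₂ , y₂) (x₃ , y₃) =
      solve 8 (λ x₀ y₀ x₁ y₁ x₂ y₂ x₃ y₃ →
        :- :orient x₁ y₁ x₂ y₂ x₃ y₃ :* x₀ :+ :orient x₂ y₂ x₃ y₃ x₀ y₀ :* x₁ :=
        :orient x₀ y₀ x₁ y₁ x₃ y₃ :* x₂ :+ :- :orient x₀ y₀ x₁ y₁ x₂ y₂ :* x₃) refl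
        x₀ y₀ x₁ y₁ x₂ y₂ x₃ y₃

    barycentric-y : ∀ p₀ p₁ p₂ p₃ →
      - orient p₁ p₂ p₃ * yOf p₀ + orient p₂ p₃ p₀ * yOf p₁ ≈
      orient p₀ p₁ p₃ * yOf p₂ + - orient p₀ p₁ p₂ * yOf p₃
    barycentric-y (x₀ , y₀) (x₁ , y₁) (x₂ , y₂) (x₃ , y₃) =
      solve 8 (λ x₀ y₀ x₁ y₁ x₂ y₂ x₃ y₃ →
        :- :orient x₁ y₁ x₂ y₂ x₃ y₃ :* y₀ :+ :orient x₂ y₂ x₃ y₃ x₀ y₀ :* y₁ :=
        :orient x₀ y₀ x₁ y₁ x₃ y₃ :* y₂ :+ :- :orient x₀ y₀ x₁ y₁ x₂ y₂ :* y₃) refl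
        x₀ y₀ x₁ y₁ x₂ y₂ x₃ y₃

    -- This is h₁ δ = h₀ β + h₂ α after subtracting h₁ α from both sides; `heights′` subtracts h₁ β
    -- instead.
    heights : ∀ σ p₀ p₁ p₂ p₃ →
      height σ p₂ p₁ * orient p₀ p₁ p₃ ≈
      height σ p₀ p₁ * - orient p₁ p₂ p₃ + (height σ p₂ p₃ - height σ p₂ p₁) * - orient p₀ p₁ p₂
    heights σ (x₀ , y₀) (x₁ , y₁) (x₂ , y₂) (x₃ , y₃) =
      solve 9 (λ σ x₀ y₀ x₁ y₁ x₂ y₂ x₃ y₃ →
        σ :* (y₁ :- y₂) :* :orient x₀ y₀ x₁ y₁ x₃ y₃ :=
        σ :* (y₁ :- y₀) :* :- :orient x₁ y₁ x₂ y₂ x₃ y₃ :+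
        (σ :* (y₃ :- y₂) :- σ :* (y₁ :- y₂)) :* :- :orient x₀ y₀ x₁ y₁ x₂ y₂) refl
        σ x₀ y₀ x₁ y₁ x₂ y₂ x₃ y₃

    heights′ : ∀ σ p₀ p₁ p₂ p₃ →
      height σ p₂ p₁ * orient p₂ p₃ p₀ ≈
      (height σ p₀ p₁ - height σ p₂ p₁) * - orient p₁ p₂ p₃ + height σ p₂ p₃ * - orient p₀ p₁ p₂
    heights′ σ (x₀ , y₀) (x₁ , y₁) (x₂ , y₂) (x₃ , y₃) =
      solve 9 (λ σ x₀ y₀ x₁ y₁ x₂ y₂ x₃ y₃ →
        σ :* (y₁ :- y₂) :* :orient x₂ y₂ x₃ y₃ x₀ y₀ :=
        (σ :* (y₁ :- y₀) :- σ :* (y₁ :- y₂)) :* :- :orient x₁ y₁ x₂ y₂ x₃ y₃ :+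
        σ :* (y₃ :- y₂) :* :- :orient x₀ y₀ x₁ y₁ x₂ y₂) refl
        σ x₀ y₀ x₁ y₁ x₂ y₂ x₃ y₃

    -- Here β is eliminated in favour of δ - α. The coefficient of α is h₀ + h₂ - h₁, the quantity
    -- whose sign decides criticality.
    heights″ : ∀ σ p₀ p₁ p₂ p₃ →
      height σ p₀ p₁ * orient p₂ p₃ p₀ ≈
      (height σ p₀ p₁ - height σ p₂ p₁) * orient p₀ p₁ p₃ + height σ p₀ p₃ * - orient p₀ p₁ p₂
    heights″ σ (x₀ , y₀) (x₁ , y₁) (x₂ , y₂) (x₃ , y₃) =
      solve 9 (λ σ x₀ y₀ x₁ y₁ x₂ y₂ x₃ y₃ →
        σ :* (y₁ :- y₀) :* :orient x₂ y₂ x₃ y₃ x₀ y₀ :=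
        (σ :* (y₁ :- y₀) :- σ :* (y₁ :- y₂)) :* :orient x₀ y₀ x₁ y₁ x₃ y₃ :+
        σ :* (y₃ :- y₀) :* :- :orient x₀ y₀ x₁ y₁ x₂ y₂) refl
        σ x₀ y₀ x₁ y₁ x₂ y₂ x₃ y₃

    -- Divided by δ = γ + α > 0, the affine dependence equates two convex combinations: the point at
    -- parameter γ′ / δ on the first segment and the one at α / δ on the second.
    segments-meet : ∀ {p₀ p₁ p₂ p₃} → Clockwise p₀ p₁ p₂ → Clockwise p₁ p₂ p₃ →
      0# ≤ orient p₀ p₁ p₃ → 0# ≤ orient p₂ p₃ p₀ → ¬ Disjoint p₀ p₁ p₂ p₃
    segments-meet {p₀} {p₁} {p₂} {p₃} 0<α 0<β 0≤γ 0≤γ′ disjoint =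
      disjoint (unit 0≤γ′ (<⇒≤ 0<β) 1-s≈) (unit (<⇒≤ 0<α) 0≤γ 1-t≈)
        (meet (barycentric-x p₀ p₁ p₂ p₃) , meet (barycentric-y p₀ p₁ p₂ p₃))
      where
      α β γ γ′ w : Carrier
      α = - orient p₀ p₁ p₂
      β = - orient p₁ p₂ p₃
      γ = orient p₀ p₁ p₃
      γ′ = orient p₂ p₃ p₀
      inv : ∃[ w ] 0# < w × (γ + α) * w ≈ 1#
      inv = inverse (+-posʳ 0≤γ 0<α)
      w = proj₁ inv
      0≤w : 0# ≤ w
      0≤w = <⇒≤ (proj₁ (proj₂ inv))
      split : ∀ x y → 1# ≈ (x + y) * w → 1# - x * w ≈ y * w
      split x y 1≈ = trans (+-congʳ 1≈) (solve 3 (λ x y w → (x :+ y) :* w :- x :* w := y :* w) refl x y w)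
      1-t≈ : 1# - α * w ≈ γ * w
      1-t≈ = split α γ (trans (sym (proj₂ (proj₂ inv))) (*-congʳ (+-comm γ α)))
      1-s≈ : 1# - γ′ * w ≈ β * w
      1-s≈ = split γ′ β (trans (sym (proj₂ (proj₂ inv))) (*-congʳ (orient-exchange p₀ p₁ p₂ p₃)))
      unit : ∀ {x y} → 0# ≤ x → 0# ≤ y → 1# - x * w ≈ y * w → UnitInterval (x * w)
      unit 0≤x 0≤y 1-xw≈yw = *-nonNeg 0≤x 0≤w , ≤-by 1-xw≈yw (*-nonNeg 0≤y 0≤w)
      meet : ∀ {a b c d} → β * a + γ′ * b ≈ γ * c + α * d →
        (1# - γ′ * w) * a + γ′ * w * b ≈ (1# - α * w) * c + α * w * d
      meet {a} {b} {c} {d} eq = begin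
        (1# - γ′ * w) * a + γ′ * w * b   ≈⟨ +-congʳ (*-congʳ 1-s≈) ⟩
        β * w * a + γ′ * w * b           ≈⟨ factor β γ′ a b ⟩
        w * (β * a + γ′ * b)             ≈⟨ *-congˡ eq ⟩
        w * (γ * c + α * d)              ≈⟨ factor γ α c d ⟨
        γ * w * c + α * w * d            ≈⟨ +-congʳ (*-congʳ 1-t≈) ⟨
        (1# - α * w) * c + α * w * d     ∎
        where
        open SetoidReasoning setoid
        factor : ∀ x y a b → x * w * a + y * w * b ≈ w * (x * a + y * b)
        factor x y a b = solve 5 (λ x y a b w → x :* w :* a :+ y :* w :* b := w :* (x :* a :+ y :* b)) refl
                           x y a b w

  -- The factor σ, later 1 or -1, covers both vertical directions of the first edge; the middle
  -- height is taken from `p₂` to `p₁` because the path reverses its vertical direction at every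
  -- vertex.
  record Spiral (σ : Carrier) (p₀ p₁ p₂ p₃ : Point) : Set (c ⊔ ℓ₁ ⊔ ℓ₃) where
    field
      height₀  : 0# < height σ p₀ p₁
      height₁  : 0# < height σ p₂ p₁
      height₂  : 0# < height σ p₂ p₃
      turn₁    : Clockwise p₀ p₁ p₂
      turn₂    : Clockwise p₁ p₂ p₃
      disjoint : Disjoint p₀ p₁ p₂ p₃

  module _ {σ p₀ p₁ p₂ p₃} (spiral : Spiral σ p₀ p₁ p₂ p₃) where
    open Spiral spiral

    opaque
      -- Under these assumptions `heights` and `heights′` make δ - α and δ - β nonnegative, so the
      -- outer edges would meet.
      middle-not-shortest : height σ p₂ p₁ ≤ height σ p₀ p₁ → ¬ (height σ p₂ p₁ ≤ height σ p₂ p₃)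
      middle-not-shortest h₁≤h₀ h₁≤h₂ = segments-meet turn₁ turn₂
        (*-cancelˡ-nonNeg height₁ (≤-respʳ (sym (heights σ p₀ p₁ p₂ p₃))
          (+-nonNeg (*-nonNeg (<⇒≤ height₀) (<⇒≤ turn₂)) (*-nonNeg (≤⇒0≤- h₁≤h₂) (<⇒≤ turn₁)))))
        (*-cancelˡ-nonNeg height₁ (≤-respʳ (sym (heights′ σ p₀ p₁ p₂ p₃))
          (+-nonNeg (*-nonNeg (≤⇒0≤- h₁≤h₀) (<⇒≤ turn₂)) (*-nonNeg (<⇒≤ height₂) (<⇒≤ turn₁)))))
        disjoint

      -- If p₃ were on the line p₀p₁, it would be on the segment p₀p₁.
      not-collinear : 0# < height σ p₀ p₃ → ¬ (orient p₀ p₁ p₃ ≈ 0#)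
      not-collinear 0<h γ≈0 = segments-meet turn₁ turn₂ (≈⇒≤ (sym γ≈0))
        (*-cancelˡ-nonNeg height₀ (≤-respʳ (sym h₀γ′≈) (<⇒≤ (*-pos 0<h turn₁))))
        disjoint
        where
        h₀γ′≈ : height σ p₀ p₁ * orient p₂ p₃ p₀ ≈ height σ p₀ p₃ * - orient p₀ p₁ p₂
        h₀γ′≈ = trans (heights″ σ p₀ p₁ p₂ p₃)
          (trans (+-congʳ (trans (*-congˡ γ≈0) (zeroʳ _))) (+-identityˡ _))

  -- Orientations and heights of linearly moving points.

  private
    :lerp : ∀ {n} (t x y : Polynomial n) → Polynomial n
    :lerp t x y = (:1 :- t) :* x :+ t :* y

  opaque
    lerp-pos : ∀ {t x y} → UnitInterval t → 0# < x → 0# < y → 0# < (1# - t) * x + t * y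
    lerp-pos {t} (0≤t , t≤1) 0<x 0<y with <-cotrans 0<1 t
    ... | inj₁ 0<t = +-posʳ (*-nonNeg (≤⇒0≤- t≤1) (<⇒≤ 0<x)) (*-pos 0<t 0<y)
    ... | inj₂ t<1 = +-posˡ (*-pos (<⇒0<- t<1) 0<x) (*-nonNeg 0≤t (<⇒≤ 0<y))

    height-lerp : ∀ σ t p p′ q q′ →
      height σ (lerp t p p′) (lerp t q q′) ≈ (1# - t) * height σ p q + t * height σ p′ q′
    height-lerp σ t (_ , p) (_ , p′) (_ , q) (_ , q′) =
      solve 6 (λ σ t p p′ q q′ → σ :* (:lerp t q q′ :- :lerp t p p′) :=
                                 :lerp t (σ :* (q :- p)) (σ :* (q′ :- p′))) refl
        σ t p p′ q q′

    -- The double negation lets the first coefficient match `- N` in `quadratic-root`, with N the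
    -- positive quantity of `Clockwise`.
    orient-lerp : ∀ t p p′ q q′ r r′ →
      orient (lerp t p p′) (lerp t q q′) (lerp t r r′) ≈
      (1# - t) * (1# - t) * - - orient p q r
        + (1# - t) * t * ((xOf q - xOf p) * (yOf r′ - yOf p′) + (xOf q′ - xOf p′) * (yOf r - yOf p)
            - ((yOf q - yOf p) * (xOf r′ - xOf p′) + (yOf q′ - yOf p′) * (xOf r - xOf p)))
        + t * t * orient p′ q′ r′
    orient-lerp t (px , py) (px′ , py′) (qx , qy) (qx′ , qy′) (rx , ry) (rx′ , ry′) =
      trans (+-cong (*-cong (difference qx qx′ px px′) (difference ry ry′ py py′))
                    (-‿cong (*-cong (difference qy qy′ py py′) (difference rx rx′ px px′))))
            (solve 9 (λ t a a′ b b′ c c′ d d′ →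
               :lerp t a a′ :* :lerp t b b′ :- :lerp t c c′ :* :lerp t d d′ :=
               (:1 :- t) :* (:1 :- t) :* :- :- (a :* b :- c :* d)
                 :+ (:1 :- t) :* t :* (a :* b′ :+ a′ :* b :- (c :* d′ :+ c′ :* d))
                 :+ t :* t :* (a′ :* b′ :- c′ :* d′)) refl
               t (qx - px) (qx′ - px′) (ry - py) (ry′ - py′) (qy - py) (qy′ - py′) (rx - px) (rx′ - px′))
      where
      difference : ∀ x x′ y y′ →
        ((1# - t) * x + t * x′) - ((1# - t) * y + t * y′) ≈ (1# - t) * (x - y) + t * (x′ - y′)
      difference x x′ y y′ =
        solve 5 (λ t x x′ y y′ → :lerp t x x′ :- :lerp t y y′ := :lerp t (x :- y) (x′ :- y′)) refl t x x′ y y′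

    -- Heights are linear in time, so `height σ p₀ p₃` is still positive at the time when
    -- `quadratic-root` makes the three points collinear.
    no-flip : ∀ {σ p₀ p₀′ p₁ p₁′ p₂ p₂′ p₃ p₃′} →
      (∀ {t} → UnitInterval t →
        Spiral σ (lerp t p₀ p₀′) (lerp t p₁ p₁′) (lerp t p₂ p₂′) (lerp t p₃ p₃′)) →
      0# < height σ p₀ p₃ → 0# < height σ p₀′ p₃′ →
      Clockwise p₀ p₁ p₃ → ¬ (0# ≤ orient p₀′ p₁′ p₃′)
    no-flip {σ} {p₀} {p₀′} {p₁} {p₁′} {p₂} {p₂′} {p₃} {p₃′} spiral 0<h 0<h′ cw 0≤γ′ =
      let t , unit , root = quadratic-root cw 0≤γ′
      in not-collinear (spiral unit)
           (<-respʳ (sym (height-lerp σ t p₀ p₀′ p₃ p₃′)) (lerp-pos unit 0<h 0<h′))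
           (trans (orient-lerp t p₀ p₀′ p₁ p₁′ p₃ p₃′) root)

-- Left-to-right order as orientation, and criteria for segments to meet.

module Segments {c ℓ₁ ℓ₂ ℓ₃} (R : RealField c ℓ₁ ℓ₂ ℓ₃) where

  open RealField R
  open Drawings R
  open RealFieldProperties R
  open PlaneGeometry R

  ≈ₚ-sym : ∀ {p q} → p ≈ₚ q → q ≈ₚ p
  ≈ₚ-sym (x≈ , y≈) = sym x≈ , sym y≈

  ≈ₚ-trans : ∀ {p q r} → p ≈ₚ q → q ≈ₚ r → p ≈ₚ r
  ≈ₚ-trans (x≈ , y≈) (x≈′ , y≈′) = trans x≈ x≈′ , trans y≈ y≈′

  Left : (v u w : Point) → Set (c ⊔ ℓ₁ ⊔ ℓ₃)
  Left v u w = ∀ {s t} → 0# < s → s ≤ 1# → 0# < t → t ≤ 1# →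
    yOf (lerp s v u) ≈ yOf (lerp t v w) → xOf (lerp s v u) < xOf (lerp t v w)

  private
    :lerp : ∀ {n} (t x y : Polynomial n) → Polynomial n
    :lerp t x y = (:1 :- t) :* x :+ t :* y

  opaque
    height-neg : ∀ σ p q → height (- σ) p q ≈ height σ q p
    height-neg σ (_ , y) (_ , y′) =
      solve 3 (λ σ y y′ → :- σ :* (y′ :- y) := σ :* (y :- y′)) refl σ y y′

    orient-swap : ∀ p q r → - orient p q r ≈ orient q p r
    orient-swap (px , py) (qx , qy) (rx , ry) =
      solve 6 (λ px py qx qy rx ry →
        :- ((qx :- px) :* (ry :- py) :- (qy :- py) :* (rx :- px)) :=
        (px :- qx) :* (ry :- qy) :- (py :- qy) :* (rx :- qx)) refl
        px py qx qy rx ry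

    orient-cong : ∀ {p p′ q q′ r r′} → p ≈ₚ p′ → q ≈ₚ q′ → r ≈ₚ r′ → orient p q r ≈ orient p′ q′ r′
    orient-cong (px , py) (qx , qy) (rx , ry) =
      +-cong (*-cong (+-cong qx (-‿cong px)) (+-cong ry (-‿cong py)))
             (-‿cong (*-cong (+-cong qy (-‿cong py)) (+-cong rx (-‿cong px))))

    orient-congʳ : ∀ p q {r s} → r ≈ₚ s → orient p q r ≈ orient p q s
    orient-congʳ p q = orient-cong {p} {p} {q} {q} (refl , refl) (refl , refl)

    orient-onʳ : ∀ p q t → orient p q (lerp t p q) ≈ 0#
    orient-onʳ (px , py) (qx , qy) t =
      solve 5 (λ px py qx qy t →
        (qx :- px) :* (:lerp t py qy :- py) :- (qy :- py) :* (:lerp t px qx :- px) := :0) refl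
        px py qx qy t

    orient-lerpʳ : ∀ p q t r s →
      - orient p q (lerp t r s) ≈ (1# - t) * - orient p q r + t * - orient p q s
    orient-lerpʳ (px , py) (qx , qy) t (rx , ry) (sx , sy) =
      solve 9 (λ px py qx qy t rx ry sx sy →
        :- ((qx :- px) :* (:lerp t ry sy :- py) :- (qy :- py) :* (:lerp t rx sx :- px)) :=
        :lerp t (:- ((qx :- px) :* (ry :- py) :- (qy :- py) :* (rx :- px)))
                (:- ((qx :- px) :* (sy :- py) :- (qy :- py) :* (sx :- px)))) refl
        px py qx qy t rx ry sx sy

    orient-turn : ∀ p q t r → - orient p q (lerp t q r) ≈ - orient p q r * t
    orient-turn (px , py) (qx , qy) t (rx , ry) =
      solve 7 (λ px py qx qy t rx ry →
        :- ((qx :- px) :* (:lerp t qy ry :- py) :- (qy :- py) :* (:lerp t qx rx :- px)) :=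
        :- ((qx :- px) :* (ry :- py) :- (qy :- py) :* (rx :- px)) :* t) refl
        px py qx qy t rx ry

    lerp-0 : ∀ {t} p q → t ≈ 0# → lerp t p q ≈ₚ p
    lerp-0 {t} (px , py) (qx , qy) t≈0 = coordinate px qx , coordinate py qy
      where
      coordinate : ∀ x y → (1# - t) * x + t * y ≈ x
      coordinate x y = trans (+-cong (*-congʳ (+-congˡ (-‿cong t≈0))) (*-congʳ t≈0))
        (solve 2 (λ x y → :lerp :0 x y := x) refl x y)

    lerp-reverse : ∀ t p q → lerp t p q ≈ₚ lerp (1# - t) q p
    lerp-reverse t (px , py) (qx , qy) = coordinate px qx , coordinate py qy
      where
      coordinate : ∀ x y → (1# - t) * x + t * y ≈ (1# - (1# - t)) * y + (1# - t) * x
      coordinate x y = solve 3 (λ t x y → :lerp t x y := :lerp (:1 :- t) y x) refl t x y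

    unit-reverse : ∀ {t} → UnitInterval t → UnitInterval (1# - t)
    unit-reverse {t} (0≤t , t≤1) =
      ≤⇒0≤- t≤1 , ≤-by (solve 1 (λ t → :1 :- (:1 :- t) := t) refl t) 0≤t

    unit-0 : UnitInterval 0#
    unit-0 = ≤-refl , 0≤1

    unit-1 : UnitInterval 1#
    unit-1 = 0≤1 , ≤-refl

    -- The orientation with respect to `p` and `q` vanishes on their line, whereas it is affine
    -- along the other segment and negative at both of its ends.
    separated : ∀ {p q r s} → Clockwise p q r → Clockwise p q s → Disjoint p q r s
    separated {p} {q} {r} {s} cw cw′ {t} {u} _ unit meet =
      <-irrefl (sym (trans (-‿cong (trans (orient-congʳ p q (≈ₚ-sym meet)) (orient-onʳ p q t)))
                           (solve 0 (:- :0 := :0) refl)))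
        (<-respʳ (sym (orient-lerpʳ p q u r s)) (lerp-pos unit cw cw′))

    -- The orientation with respect to `p` and `q` vanishes at the meeting point, but along the
    -- second edge it is a nonzero multiple of the parameter `u`; hence `u` is 0.
    meet-at-turn : ∀ {p q r t u} → Clockwise p q r → lerp t p q ≈ₚ lerp u q r → lerp t p q ≈ₚ q
    meet-at-turn {p} {q} {r} {t} {u} cw meet = ≈ₚ-trans meet (lerp-0 q r (*-cancelˡ-≈0 cw (begin
      - orient p q r * u         ≈⟨ orient-turn p q u r ⟨
      - orient p q (lerp u q r)  ≈⟨ -‿cong (orient-congʳ p q (≈ₚ-sym meet)) ⟩
      - orient p q (lerp t p q)  ≈⟨ -‿cong (orient-onʳ p q t) ⟩
      - 0#                       ≈⟨ solve 0 (:- :0 := :0) refl ⟩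
      0#                         ∎)))
      where open SetoidReasoning setoid

    Disjoint-sym : ∀ {p q r s} → Disjoint p q r s → Disjoint r s p q
    Disjoint-sym disjoint unit unit′ meet = disjoint unit′ unit (≈ₚ-sym meet)

    lerp-increasing : ∀ {p q s t} → yOf p < yOf q → s < t → yOf (lerp s p q) < yOf (lerp t p q)
    lerp-increasing {_ , p} {_ , q} {s} {t} p<q s<t =
      <-by (solve 4 (λ p q s t → :lerp t p q :- :lerp s p q := (t :- s) :* (q :- p)) refl p q s t)
           (*-pos (<⇒0<- s<t) (<⇒0<- p<q))

    lerp-increasing⇒< : ∀ {p q} → yOf (lerp 0# p q) < yOf (lerp 1# p q) → yOf p < yOf q
    lerp-increasing⇒< {_ , p} {_ , q} =
      <-respʳ (solve 2 (λ p q → :lerp :1 p q := q) refl p q)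
        ∘ <-respˡ (solve 2 (λ p q → :lerp :0 p q := p) refl p q)

    -- One horizontal line suffices: for edges of heights a and b, the parameters b / (a + b) and a
    -- / (a + b) give points at the same level.
    left⇒orient : ∀ {τ v u w} → 0# < height τ v u → 0# < height τ v w → Left v u w →
      0# < τ * orient v w u
    left⇒orient {τ} {vx , vy} {ux , uy} {wx , wy} 0<a 0<b left =
      *-cancelˡ-pos 0<z (<-respʳ difference (<⇒0<- (left
        (*-pos 0<b 0<z) (unit 0<a 1-bz≈az) (*-pos 0<a 0<z) (unit 0<b 1-az≈bz) same-height)))
      where
      a b z : Carrier
      a = τ * (uy - vy)
      b = τ * (wy - vy)
      inv : ∃[ z ] 0# < z × (a + b) * z ≈ 1#
      inv = inverse (+-pos 0<a 0<b)
      z = proj₁ inv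
      0<z : 0# < z
      0<z = proj₁ (proj₂ inv)
      1-bz≈az : 1# - b * z ≈ a * z
      1-bz≈az = trans (+-congʳ (sym (proj₂ (proj₂ inv))))
        (solve 3 (λ a b z → (a :+ b) :* z :- b :* z := a :* z) refl a b z)
      1-az≈bz : 1# - a * z ≈ b * z
      1-az≈bz = trans (+-congʳ (sym (proj₂ (proj₂ inv))))
        (solve 3 (λ a b z → (a :+ b) :* z :- a :* z := b :* z) refl a b z)
      unit : ∀ {x y} → 0# < x → 1# - y * z ≈ x * z → y * z ≤ 1#
      unit 0<x 1-yz≈xz = ≤-by 1-yz≈xz (<⇒≤ (*-pos 0<x 0<z))
      same-height : (1# - b * z) * vy + b * z * uy ≈ (1# - a * z) * vy + a * z * wy
      same-height = solve 5 (λ τ vy uy wy z →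
        :lerp (τ :* (wy :- vy) :* z) vy uy := :lerp (τ :* (uy :- vy) :* z) vy wy) refl τ vy uy wy z
      difference : ((1# - a * z) * vx + a * z * wx) - ((1# - b * z) * vx + b * z * ux) ≈
                   z * (τ * ((wx - vx) * (uy - vy) - (wy - vy) * (ux - vx)))
      difference = solve 8 (λ τ vx vy ux uy wx wy z →
        :lerp (τ :* (uy :- vy) :* z) vx wx :- :lerp (τ :* (wy :- vy) :* z) vx ux :=
        z :* (τ :* ((wx :- vx) :* (uy :- vy) :- (wy :- vy) :* (ux :- vx)))) refl τ vx vy ux uy wx wy z

    orient⇒left : ∀ {τ v u w} → 0# < height τ v w → 0# < τ * orient v w u → Left v u w
    orient⇒left {τ} {vx , vy} {ux , uy} {wx , wy} 0<b 0<o {s} {t} 0<s _ _ _ same-height =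
      <-by refl (*-cancelˡ-pos 0<b (<-respʳ (sym eq) (*-pos 0<s 0<o)))
      where
      open SetoidReasoning setoid
      ys yt X : Carrier
      ys = (1# - s) * vy + s * uy
      yt = (1# - t) * vy + t * wy
      X  = ((1# - t) * vx + t * wx) - ((1# - s) * vx + s * ux)
      eq : τ * (wy - vy) * X ≈ s * (τ * ((wx - vx) * (uy - vy) - (wy - vy) * (ux - vx)))
      eq = begin
        τ * (wy - vy) * X
          ≈⟨ solve 9 (λ τ vx vy ux uy wx wy s t →
               τ :* (wy :- vy) :* (:lerp t vx wx :- :lerp s vx ux) :=
               s :* (τ :* ((wx :- vx) :* (uy :- vy) :- (wy :- vy) :* (ux :- vx)))
                 :+ τ :* (wx :- vx) :* (:lerp t vy wy :- :lerp s vy uy)) refl τ vx vy ux uy wx wy s t ⟩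
        s * (τ * ((wx - vx) * (uy - vy) - (wy - vy) * (ux - vx))) + τ * (wx - vx) * (yt - ys)
          ≈⟨ +-congˡ (trans (*-congˡ (trans (+-congˡ (-‿cong same-height)) (-‿inverseʳ yt))) (zeroʳ _)) ⟩
        s * (τ * ((wx - vx) * (uy - vy) - (wy - vy) * (ux - vx))) + 0#
          ≈⟨ +-identityʳ _ ⟩
        s * (τ * ((wx - vx) * (uy - vy) - (wy - vy) * (ux - vx))) ∎

-- The alternating path and the lists of its embedding.

isEven : ℕ → Bool
isEven zero    = true
isEven (suc n) = not (isEven n)

Even Odd : ℕ → Set
Even n = isEven n ≡ true
Odd n  = isEven n ≡ false

even⊎odd : ∀ n → Even n ⊎ Odd n
even⊎odd n with isEven n
... | true  = inj₁ ≡.refl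
... | false = inj₂ ≡.refl

¬even×odd : ∀ n → Even n → ¬ Odd n
¬even×odd n even odd with () ← ≡.trans (≡.sym even) odd

module _ {n : ℕ} where

  infix 4 _↷_
  _↷_ : Rel (Fin n) 0ℓ
  u ↷ v = toℕ v ≡ suc (toℕ u)

  ↷-odd : ∀ {u v} → u ↷ v → Even (toℕ u) → Odd (toℕ v)
  ↷-odd u↷v even = ≡.trans (≡.cong isEven u↷v) (≡.cong not even)

  ↷-even : ∀ {u v} → u ↷ v → Odd (toℕ u) → Even (toℕ v)
  ↷-even u↷v odd = ≡.trans (≡.cong isEven u↷v) (≡.cong not odd)

  ↷-even⁻ : ∀ {u v} → u ↷ v → Odd (toℕ v) → Even (toℕ u)
  ↷-even⁻ {u} {v} u↷v odd with even⊎odd (toℕ u)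
  ... | inj₁ even = even
  ... | inj₂ odd′ = ⊥-elim (¬even×odd (toℕ v) (↷-even {u} {v} u↷v odd′) odd)

  ↷⇒< : ∀ {u v} → u ↷ v → u Fin.< v
  ↷⇒< u↷v = ℕ.≤-reflexive (≡.sym u↷v)

  <⇒≢ : ∀ {u v : Fin n} → u Fin.< v → u ≢ v
  <⇒≢ u<v ≡.refl = ℕ.<-irrefl ≡.refl u<v

  no-common-end : ∀ {u v u′ v′} → u ↷ v → v Fin.< u′ → u′ ↷ v′ →
    ∀ {w} → w ≡ u ⊎ w ≡ v → ¬ (w ≡ u′ ⊎ w ≡ v′)
  no-common-end {u} {v} {u′} {v′} u↷v v<u′ u′↷v′ w∈uv w∈u′v′ =
    ℕ.<-irrefl ≡.refl (ℕ.≤-<-trans (w≤v w∈uv) (ℕ.<-≤-trans v<u′ (u′≤w w∈u′v′)))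
    where
    w≤v : ∀ {w} → w ≡ u ⊎ w ≡ v → w Fin.≤ v
    w≤v (inj₁ ≡.refl) = ℕ.<⇒≤ (↷⇒< {u} {v} u↷v)
    w≤v (inj₂ ≡.refl) = ℕ.≤-refl
    u′≤w : ∀ {w} → w ≡ u′ ⊎ w ≡ v′ → u′ Fin.≤ w
    u′≤w (inj₁ ≡.refl) = ℕ.≤-refl
    u′≤w (inj₂ ≡.refl) = ℕ.<⇒≤ (↷⇒< {u′} {v′} u′↷v′)

  zigzag : Digraph n
  zigzag = record
    { _⟶_  = λ u v → Even (toℕ u) × (u ↷ v ⊎ v ↷ u)
    ; _⟶?_ = λ u v → (isEven (toℕ u) Bool.≟ true)
                     ×-dec ((toℕ v ℕ.≟ suc (toℕ u)) ⊎-dec (toℕ u ℕ.≟ suc (toℕ v)))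
    }

  zigzag-path : UnderlyingPath zigzag
  zigzag-path = Permutation.id , λ u v → mk⇔ to (from u v)
    where
    open Digraph zigzag
    to : ∀ {u v} → u ∼ v → u ↷ v ⊎ v ↷ u
    to (inj₁ (_ , uv)) = uv
    to (inj₂ (_ , inj₁ vu)) = inj₂ vu
    to (inj₂ (_ , inj₂ uv)) = inj₁ uv
    from : ∀ u v → u ↷ v ⊎ v ↷ u → u ∼ v
    from u v uv with even⊎odd (toℕ u) | uv
    ... | inj₁ even | _       = inj₁ (even , uv)
    ... | inj₂ odd  | inj₁ u↷v = inj₂ (↷-even {u} {v} u↷v odd , inj₂ u↷v)
    ... | inj₂ odd  | inj₂ v↷u = inj₂ (↷-even⁻ {v} {u} v↷u odd , inj₁ v↷u)

next prev : ∀ {n} → Fin n → List (Fin n)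
next {n} v with suc (toℕ v) ℕ.<? n
... | yes v+1<n = Fin.fromℕ< v+1<n ∷ []
... | no  _     = []
prev Fin.zero    = []
prev (Fin.suc v) = Fin.inject₁ v ∷ []

∈-next : ∀ {n} {u v : Fin n} → u ∈ next v ⇔ v ↷ u
∈-next {n} {u} {v} with suc (toℕ v) ℕ.<? n
... | yes v+1<n = mk⇔
  (λ { (here ≡.refl) → Fin.toℕ-fromℕ< v+1<n })
  (λ v↷u → here (Fin.toℕ-injective (≡.trans v↷u (≡.sym (Fin.toℕ-fromℕ< v+1<n)))))
... | no  v+1≮n = mk⇔ (λ ()) (λ v↷u → ⊥-elim (v+1≮n (≡.subst (ℕ._< n) v↷u (Fin.toℕ<n u))))

∈-prev : ∀ {n} {u v : Fin n} → u ∈ prev v ⇔ u ↷ v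
∈-prev {v = Fin.zero}  = mk⇔ (λ ()) (λ ())
∈-prev {v = Fin.suc v} = mk⇔
  (λ { (here ≡.refl) → ≡.cong suc (≡.sym (Fin.toℕ-inject₁ v)) })
  (λ u↷v → here (Fin.toℕ-injective (≡.trans (≡.sym (ℕ.suc-injective u↷v)) (≡.sym (Fin.toℕ-inject₁ v)))))

module _ {a ℓ} {A : Set a} {R : Rel A ℓ} where

  AllPairs-++⁻ : ∀ {xs ys} → AllPairs R (xs ++ ys) → ∀ {x y} → x ∈ xs → y ∈ ys → R x y
  AllPairs-++⁻ (Rx ∷ _) (here ≡.refl) y∈ys = All.lookup Rx (∈.∈-++⁺ʳ _ y∈ys)
  AllPairs-++⁻ (_ ∷ R*) (there x∈xs)  y∈ys = AllPairs-++⁻ R* x∈xs y∈ys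

  AllPairs-++⁺ : ∀ {xs ys} → AllPairs R xs → AllPairs R ys →
    (∀ {x y} → x ∈ xs → y ∈ ys → R x y) → AllPairs R (xs ++ ys)
  AllPairs-++⁺ Rxs Rys Rxy =
    AllPairs.++⁺ Rxs Rys (All.tabulate λ x∈xs → All.tabulate λ y∈ys → Rxy x∈xs y∈ys)

module _ {n ℓ} {R : Rel (Fin n) ℓ} where

  AllPairs-next : ∀ v → AllPairs R (next v)
  AllPairs-next v with suc (toℕ v) ℕ.<? n
  ... | yes _ = [] ∷ []
  ... | no  _ = []

  AllPairs-prev : ∀ v → AllPairs R (prev v)
  AllPairs-prev Fin.zero    = []
  AllPairs-prev (Fin.suc _) = [] ∷ []

∈-++ : ∀ {n} {P Q : Set} {u : Fin n} {xs ys} → u ∈ xs ⇔ P → u ∈ ys ⇔ Q → u ∈ xs ++ ys ⇔ (P ⊎ Q)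
∈-++ {xs = xs} xs⇔ ys⇔ = mk⇔
  ([ inj₁ ∘ Equivalence.to xs⇔ , inj₂ ∘ Equivalence.to ys⇔ ]′ ∘ ∈.∈-++⁻ xs)
  [ ∈.∈-++⁺ˡ ∘ Equivalence.from xs⇔ , ∈.∈-++⁺ʳ xs ∘ Equivalence.from ys⇔ ]′

-- Both orders say that the path turns clockwise at v.
sources-list sinks-list : ∀ {n} → Fin n → List (Fin n)
sources-list v = if isEven (toℕ v) then next v ++ prev v else []
sinks-list v   = if isEven (toℕ v) then [] else prev v ++ next v

sources-list-even : ∀ {n} (v : Fin n) → Even (toℕ v) → sources-list v ≡ next v ++ prev v
sources-list-even v = ≡.cong (if_then next v ++ prev v else [])

sources-list-odd : ∀ {n} (v : Fin n) → Odd (toℕ v) → sources-list v ≡ []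
sources-list-odd v = ≡.cong (if_then next v ++ prev v else [])

sinks-list-even : ∀ {n} (v : Fin n) → Even (toℕ v) → sinks-list v ≡ []
sinks-list-even v = ≡.cong (if_then [] else prev v ++ next v)

sinks-list-odd : ∀ {n} (v : Fin n) → Odd (toℕ v) → sinks-list v ≡ prev v ++ next v
sinks-list-odd v = ≡.cong (if_then [] else prev v ++ next v)

-- Every drawing of the embedded path consists of spirals of three edges.

module Realisations {c ℓ₁ ℓ₂ ℓ₃} (R : RealField c ℓ₁ ℓ₂ ℓ₃) where

  open RealField R
  open Drawings R
  open RealFieldProperties R
  open PlaneGeometry R
  open Segments R

  -- Even vertices are sources, so this is the vertical direction of the path from position n to n +
  -- 1.
  sign : ℕ → Carrier
  sign n = if isEven n then 1# else - 1#

  sign-even : ∀ {n} → Even n → sign n ≡ 1#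
  sign-even = ≡.cong (if_then 1# else - 1#)

  sign-odd : ∀ {n} → Odd n → sign n ≡ - 1#
  sign-odd = ≡.cong (if_then 1# else - 1#)

  sign-suc : ∀ n → sign (suc n) ≈ - sign n
  sign-suc n with isEven n
  ... | true  = refl
  ... | false = solve 0 (:1 := :- :- :1) refl

  height-1 : ∀ {p q} → height 1# p q ≈ yOf q - yOf p
  height-1 = *-identityˡ _

  height-[-1] : ∀ {p q} → height (- 1#) p q ≈ yOf p - yOf q
  height-[-1] {_ , p} {_ , q} = solve 2 (λ p q → :- :1 :* (q :- p) := p :- q) refl p q

  module _ {n} {Γ : Drawing n} (Γ-realises : Realises zigzag Γ sources-list sinks-list) where
    open Realises Γ-realises
    open UpwardPlanarDrawing upwardPlanar
    open Digraph (zigzag {n}) using (_⟶_)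

    edge-rises : ∀ {u v} → u ⟶ v → yOf (Γ u) < yOf (Γ v)
    edge-rises uv = lerp-increasing⇒< {p = Γ _} {q = Γ _} (upward uv unit-0 unit-1 0<1)

    height-pos : ∀ {u v} → u ↷ v → 0# < height (sign (toℕ u)) (Γ u) (Γ v)
    height-pos {u} {v} u↷v with even⊎odd (toℕ u)
    ... | inj₁ even rewrite sign-even {toℕ u} even =
      <-respʳ (sym (height-1 {Γ u} {Γ v})) (<⇒0<- (edge-rises (even , inj₁ u↷v)))
    ... | inj₂ odd rewrite sign-odd {toℕ u} odd =
      <-respʳ (sym (height-[-1] {Γ u} {Γ v})) (<⇒0<- (edge-rises (↷-even {u = u} {v} u↷v odd , inj₂ u↷v)))

    -- At a sink both edges hang below `v`, whence τ = -1 there; this sign compensates for the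
    -- reversed order of the two neighbours in the list.
    turns-clockwise : ∀ {u v w} → u ↷ v → v ↷ w → Clockwise (Γ u) (Γ v) (Γ w)
    turns-clockwise {u} {v} {w} u↷v v↷w with even⊎odd (toℕ v)
    ... | inj₁ even = <-respʳ (trans (*-identityˡ _) (sym (orient-swap (Γ u) (Γ v) (Γ w))))
      (left⇒orient {1#} {Γ v} {Γ w} {Γ u} (above (inj₁ v↷w)) (above (inj₂ u↷v)) left)
      where
      above : ∀ {u′} → v ↷ u′ ⊎ u′ ↷ v → 0# < height 1# (Γ v) (Γ u′)
      above {u′} adjacent = <-respʳ (sym (height-1 {Γ v} {Γ u′})) (<⇒0<- (edge-rises (even , adjacent)))
      left : LeftOf zigzag Γ v w u
      left = AllPairs-++⁻ (≡.subst (AllPairs _) (sources-list-even v even) (proj₂ (successors v)))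
        (Equivalence.from ∈-next v↷w) (Equivalence.from ∈-prev u↷v)
    ... | inj₂ odd = <-respʳ (trans (solve 1 (λ o → :- :1 :* o := :- o) refl _)
                                    (-‿cong (sym (orient-cyclic (Γ u) (Γ v) (Γ w)))))
      (left⇒orient { - 1#} {Γ v} {Γ u} {Γ w} (below (↷-even⁻ {u = u} {v} u↷v odd) (inj₁ u↷v))
        (below (↷-even {u = v} {w} v↷w odd) (inj₂ v↷w)) left)
      where
      below : ∀ {u′} → Even (toℕ u′) → u′ ↷ v ⊎ v ↷ u′ → 0# < height (- 1#) (Γ v) (Γ u′)
      below {u′} even adjacent =
        <-respʳ (sym (height-[-1] {Γ v} {Γ u′})) (<⇒0<- (edge-rises (even , adjacent)))
      left : LeftOf zigzag Γ v u w
      left = AllPairs-++⁻ (≡.subst (AllPairs _) (sinks-list-odd v odd) (proj₂ (predecessors v)))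
        (Equivalence.from ∈-prev u↷v) (Equivalence.from ∈-next v↷w)

    disjoint-edges : ∀ {u v u′ v′} → u ↷ v → v ↷ u′ → u′ ↷ v′ → Disjoint (Γ u) (Γ v) (Γ u′) (Γ v′)
    disjoint-edges {u} {v} {u′} {v′} u↷v v↷u′ u′↷v′ {s} {t} us ut meet with even⊎odd (toℕ u)
    ... | inj₁ even =
      let w , w∈uv , w∈u′v′ , _ = planar (even , inj₁ u↷v) (even′ , inj₁ u′↷v′) uv≢u′v′ us ut meet
      in no-common-end {u = u} {v} u↷v (↷⇒< {u = v} {u′} v↷u′) u′↷v′ w∈uv w∈u′v′
      where
      even′ : Even (toℕ u′)
      even′ = ↷-even {u = v} {u′} v↷u′ (↷-odd {u = u} {v} u↷v even)
      uv≢u′v′ : (u , v) ≢ (u′ , v′)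
      uv≢u′v′ = <⇒≢ (ℕ.<-trans (↷⇒< {u = u} {v} u↷v) (↷⇒< {u = v} {u′} v↷u′)) ∘ ≡.cong proj₁
    -- Both edges are now directed against the path, so the parameters are reversed before `planar`
    -- applies.
    ... | inj₂ odd =
      let w , w∈vu , w∈v′u′ , _ = planar (even , inj₂ u↷v) (even′ , inj₂ u′↷v′) vu≢v′u′
            (unit-reverse us) (unit-reverse ut)
            (≈ₚ-trans (≈ₚ-sym (lerp-reverse s (Γ u) (Γ v)))
              (≈ₚ-trans meet (lerp-reverse t (Γ u′) (Γ v′))))
      in no-common-end {u = u} {v} u↷v (↷⇒< {u = v} {u′} v↷u′) u′↷v′ (⊎.swap w∈vu) (⊎.swap w∈v′u′)
      where
      even : Even (toℕ v)
      even = ↷-even {u = u} {v} u↷v odd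
      even′ : Even (toℕ v′)
      even′ = ↷-even {u = u′} {v′} u′↷v′ (↷-odd {u = v} {u′} v↷u′ even)
      vu≢v′u′ : (v , u) ≢ (v′ , u′)
      vu≢v′u′ = <⇒≢ (ℕ.<-trans (↷⇒< {u = v} {u′} v↷u′) (↷⇒< {u = u′} {v′} u′↷v′)) ∘ ≡.cong proj₁

    spiral : ∀ {u₀ u₁ u₂ u₃} → u₀ ↷ u₁ → u₁ ↷ u₂ → u₂ ↷ u₃ →
      Spiral (sign (toℕ u₀)) (Γ u₀) (Γ u₁) (Γ u₂) (Γ u₃)
    spiral {u₀} {u₁} {u₂} {u₃} u₀↷u₁ u₁↷u₂ u₂↷u₃ = record
      { height₀  = height-pos u₀↷u₁
      ; height₁  = <-respʳ (trans (*-congʳ sign₁) (height-neg (sign (toℕ u₀)) (Γ u₁) (Γ u₂)))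
                         (height-pos u₁↷u₂)
      ; height₂  = <-respʳ (*-congʳ sign₂) (height-pos u₂↷u₃)
      ; turn₁    = turns-clockwise u₀↷u₁ u₁↷u₂
      ; turn₂    = turns-clockwise u₁↷u₂ u₂↷u₃
      ; disjoint = disjoint-edges u₀↷u₁ u₁↷u₂ u₂↷u₃
      }
      where
      sign₁ : sign (toℕ u₁) ≈ - sign (toℕ u₀)
      sign₁ = trans (reflexive (≡.cong sign u₀↷u₁)) (sign-suc (toℕ u₀))
      sign₂ : sign (toℕ u₂) ≈ sign (toℕ u₀)
      sign₂ = trans (reflexive (≡.cong sign u₁↷u₂)) (trans (sign-suc (toℕ u₁))
        (trans (-‿cong sign₁) (solve 1 (λ x → :- :- x := x) refl (sign (toℕ u₀)))))

-- The lists enumerate exactly the successors and predecessors.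

module _ {n : ℕ} where
  open Digraph (zigzag {n})

  ⟶⇒odd : ∀ {u v} → u ⟶ v → Odd (toℕ v)
  ⟶⇒odd {u} {v} (even , inj₁ u↷v) = ↷-odd {u = u} {v} u↷v even
  ⟶⇒odd {u} {v} (even , inj₂ v↷u) with even⊎odd (toℕ v)
  ... | inj₁ even′ = ⊥-elim (¬even×odd (toℕ u) even (↷-odd {u = v} {u} v↷u even′))
  ... | inj₂ odd   = odd

  adjacent-even : ∀ {u v : Fin n} → Odd (toℕ v) → u ↷ v ⊎ v ↷ u → Even (toℕ u)
  adjacent-even {u} {v} odd (inj₁ u↷v) = ↷-even⁻ {u = u} {v} u↷v odd
  adjacent-even {u} {v} odd (inj₂ v↷u) = ↷-even {u = v} {u} v↷u odd

  ∈-sources-list : ∀ v u → u ∈ sources-list v ⇔ v ⟶ u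
  ∈-sources-list v u with even⊎odd (toℕ v)
  ... | inj₁ even rewrite sources-list-even v even =
    mk⇔ ((even ,_) ∘ Equivalence.to e) (Equivalence.from e ∘ proj₂)
    where
    e : u ∈ next v ++ prev v ⇔ (v ↷ u ⊎ u ↷ v)
    e = ∈-++ ∈-next ∈-prev
  ... | inj₂ odd rewrite sources-list-odd v odd =
    mk⇔ (λ ()) (λ (even , _) → ⊥-elim (¬even×odd (toℕ v) even odd))

  ∈-sinks-list : ∀ v u → u ∈ sinks-list v ⇔ u ⟶ v
  ∈-sinks-list v u with even⊎odd (toℕ v)
  ... | inj₁ even rewrite sinks-list-even v even =
    mk⇔ (λ ()) (λ uv → ⊥-elim (¬even×odd (toℕ v) even (⟶⇒odd {u} {v} uv)))
  ... | inj₂ odd rewrite sinks-list-odd v odd =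
    mk⇔ (λ u∈ → let uv = Equivalence.to e u∈ in adjacent-even {u} {v} odd uv , uv)
        (Equivalence.from e ∘ proj₂)
    where
    e : u ∈ prev v ++ next v ⇔ (u ↷ v ⊎ v ↷ u)
    e = ∈-++ ∈-prev ∈-next

  module _ {ℓ} {Q : Rel (Fin n) ℓ} where

    sources-list-ordered : ∀ v → (∀ {u w} → Even (toℕ v) → u ↷ v → v ↷ w → Q w u) →
      AllPairs Q (sources-list v)
    sources-list-ordered v Qwu with even⊎odd (toℕ v)
    ... | inj₁ even rewrite sources-list-even v even =
      AllPairs-++⁺ (AllPairs-next v) (AllPairs-prev v)
        λ w∈ u∈ → Qwu even (Equivalence.to ∈-prev u∈) (Equivalence.to ∈-next w∈)
    ... | inj₂ odd rewrite sources-list-odd v odd = []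

    sinks-list-ordered : ∀ v → (∀ {u w} → Odd (toℕ v) → u ↷ v → v ↷ w → Q u w) →
      AllPairs Q (sinks-list v)
    sinks-list-ordered v Quw with even⊎odd (toℕ v)
    ... | inj₁ even rewrite sinks-list-even v even = []
    ... | inj₂ odd rewrite sinks-list-odd v odd =
      AllPairs-++⁺ (AllPairs-prev v) (AllPairs-next v)
        λ u∈ w∈ → Quw odd (Equivalence.to ∈-prev u∈) (Equivalence.to ∈-next w∈)

-- Initial segments of infinite spirals are drawings of the path.

module InfiniteSpirals {c ℓ₁ ℓ₂ ℓ₃} (R : RealField c ℓ₁ ℓ₂ ℓ₃) where

  open RealField R
  open Drawings R
  open RealFieldProperties R
  open PlaneGeometry R
  open Segments R
  open Realisations R

  record InfiniteSpiral (p : ℕ → Point) : Set (c ⊔ ℓ₁ ⊔ ℓ₃) where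
    field
      rises : ∀ i → 0# < height (sign i) (p i) (p (suc i))
      turns : ∀ i → Clockwise (p i) (p (suc i)) (p (suc (suc i)))
      apart : ∀ {i j} → suc i ℕ.< j → Disjoint (p i) (p (suc i)) (p j) (p (suc j))

  module _ {p : ℕ → Point} (p-spiral : InfiniteSpiral p) where
    open InfiniteSpiral p-spiral

    points-distinct : ∀ {i j} → i ℕ.< j → ¬ (p i ≈ₚ p j)
    points-distinct {i} {j} i<j pᵢ≈pⱼ with ℕ.m≤n⇒m<n∨m≡n i<j
    ... | inj₁ i+1<j  = apart i+1<j unit-0 unit-0
      (≈ₚ-trans (lerp-0 (p i) (p (suc i)) refl)
        (≈ₚ-trans pᵢ≈pⱼ (≈ₚ-sym (lerp-0 (p j) (p (suc j)) refl))))
    ... | inj₂ ≡.refl = <-irrefl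
      (sym (trans (*-congˡ (trans (+-congˡ (-‿cong (proj₂ pᵢ≈pⱼ))) (-‿inverseʳ _))) (zeroʳ _)))
      (rises i)

    module _ {n : ℕ} where
      open Digraph (zigzag {n})

      Γ : Drawing n
      Γ v = p (toℕ v)

      height-rises : ∀ {u v : Fin n} → u ↷ v → 0# < height (sign (toℕ u)) (Γ u) (Γ v)
      height-rises {u} u↷v =
        ≡.subst (λ j → 0# < height (sign (toℕ u)) (Γ u) (p j)) (≡.sym u↷v) (rises (toℕ u))

      edge-ascends : ∀ {u v} → u ⟶ v → 0# < yOf (Γ v) - yOf (Γ u)
      edge-ascends {u} {v} (even , inj₁ u↷v) =
        <-respʳ (trans (*-congʳ (reflexive (sign-even {toℕ u} even))) (height-1 {Γ u} {Γ v}))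
                (height-rises u↷v)
      edge-ascends {u} {v} (even , inj₂ v↷u) =
        <-respʳ (trans (*-congʳ (reflexive (sign-odd {toℕ v} (⟶⇒odd {u = u} {v} (even , inj₂ v↷u)))))
                       (height-[-1] {Γ v} {Γ u}))
                (height-rises v↷u)

      turn-at : ∀ {u v w : Fin n} → u ↷ v → v ↷ w → Clockwise (Γ u) (Γ v) (Γ w)
      turn-at {u} {v} {w} u↷v v↷w = ≡.subst₂ (λ j k → Clockwise (Γ u) (p j) (p k))
        (≡.sym u↷v) (≡.sym (≡.trans v↷w (≡.cong suc u↷v))) (turns (toℕ u))

      apart-at : ∀ {u v u′ v′ : Fin n} → u ↷ v → v Fin.< u′ → u′ ↷ v′ → Disjoint (Γ u) (Γ v) (Γ u′) (Γ v′)
      apart-at {u} {v} {u′} u↷v v<u′ u′↷v′ = ≡.subst₂ (λ j k → Disjoint (Γ u) (p j) (Γ u′) (p k))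
        (≡.sym u↷v) (≡.sym u′↷v′) (apart (≡.subst (ℕ._< toℕ u′) u↷v v<u′))

      -- A directed edge read in the direction of the path. Two edges can then be compared by the
      -- positions of their tails, whatever their directions.
      record Traversal (u v : Fin n) : Set (c ⊔ ℓ₁ ⊔ ℓ₃) where
        field
          {tail head} : Fin n
          step        : tail ↷ head
          ends        : (tail ≡ u × head ≡ v) ⊎ (tail ≡ v × head ≡ u)
          reparam     : ∀ {s} → UnitInterval s →
            ∃[ s′ ] UnitInterval s′ × lerp s (Γ u) (Γ v) ≈ₚ lerp s′ (Γ tail) (Γ head)

        tail∈ : tail ≡ u ⊎ tail ≡ v
        tail∈ = ⊎.map proj₁ proj₁ ends

        head∈ : head ≡ u ⊎ head ≡ v
        head∈ = ⊎.swap (⊎.map proj₂ proj₂ ends)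

      traverse : ∀ {u v} → u ⟶ v → Traversal u v
      traverse (_ , inj₁ u↷v) = record
        { step = u↷v ; ends = inj₁ (≡.refl , ≡.refl) ; reparam = λ us → _ , us , (refl , refl) }
      traverse (_ , inj₂ v↷u) = record
        { step = v↷u ; ends = inj₂ (≡.refl , ≡.refl)
        ; reparam = λ {s} us → _ , unit-reverse us , lerp-reverse s _ _ }

      meet-later : ∀ {u₀ u₁ v₀ v₁ s t} → u₀ ↷ u₁ → v₀ ↷ v₁ → u₀ Fin.< v₀ →
        UnitInterval s → UnitInterval t → lerp s (Γ u₀) (Γ u₁) ≈ₚ lerp t (Γ v₀) (Γ v₁) →
        u₁ ≡ v₀ × lerp s (Γ u₀) (Γ u₁) ≈ₚ Γ u₁
      meet-later {u₀} {u₁} {v₀} {v₁} u₀↷u₁ v₀↷v₁ u₀<v₀ us ut meet with ℕ.m≤n⇒m<n∨m≡n u₀<v₀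
      ... | inj₁ u₁<v₀ = ⊥-elim
        (apart-at {u₀} {u₁} {v₀} {v₁} u₀↷u₁ (≡.subst (ℕ._< toℕ v₀) (≡.sym u₀↷u₁) u₁<v₀) v₀↷v₁ us ut meet)
      ... | inj₂ u₁≡v₀ with ≡.refl ← Fin.toℕ-injective {i = u₁} {v₀} (≡.trans u₀↷u₁ u₁≡v₀) =
        ≡.refl , meet-at-turn (turn-at {u₀} {u₁} {v₁} u₀↷u₁ v₀↷v₁) meet

      planar : Planar zigzag Γ
      planar {u} {v} {u′} {v′} uv u′v′ uv≢u′v′ us ut meet
        with traverse uv | traverse u′v′
      ... | e | e′
        with Traversal.reparam e us | Traversal.reparam e′ ut
      ... | s′ , us′ , eq | t′ , ut′ , eq′
        with ℕ.<-cmp (toℕ (Traversal.tail e)) (toℕ (Traversal.tail e′))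
      ... | tri< tail<tail′ _ _ =
        let head≡tail′ , at = meet-later (Traversal.step e) (Traversal.step e′) tail<tail′ us′ ut′
              (≈ₚ-trans (≈ₚ-sym eq) (≈ₚ-trans meet eq′))
        in Traversal.head e , Traversal.head∈ e
           , ≡.subst (λ w → w ≡ u′ ⊎ w ≡ v′) (≡.sym head≡tail′) (Traversal.tail∈ e′) , ≈ₚ-trans eq at
      ... | tri> _ _ tail′<tail =
        let head′≡tail , at = meet-later (Traversal.step e′) (Traversal.step e) tail′<tail ut′ us′
              (≈ₚ-trans (≈ₚ-sym eq′) (≈ₚ-trans (≈ₚ-sym meet) eq))
        in Traversal.head e′ , ≡.subst (λ w → w ≡ u ⊎ w ≡ v) (≡.sym head′≡tail) (Traversal.tail∈ e)
           , Traversal.head∈ e′ , ≈ₚ-trans meet (≈ₚ-trans eq′ at)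
      -- Equal tails mean the same step of the path; the directed edges could then differ only by
      -- direction, which would make some vertex both a source and a sink.
      ... | tri≈ _ tail≡tail′ _ = ⊥-elim (same-edge (Fin.toℕ-injective tail≡tail′)
              (Fin.toℕ-injective (≡.trans (Traversal.step e)
                (≡.trans (≡.cong suc tail≡tail′) (≡.sym (Traversal.step e′)))))
              (Traversal.ends e) (Traversal.ends e′))
        where
        ¬tail≡head : ∀ {a b a′ b′} → a ⟶ b → a′ ⟶ b′ → ¬ (a ≡ b′)
        ¬tail≡head {a} {a′ = a′} ab a′b′ ≡.refl = ¬even×odd (toℕ a) (proj₁ ab) (⟶⇒odd {u = a′} {a} a′b′)
        same-edge : ∀ {tail head tail′ head′} → tail ≡ tail′ → head ≡ head′ →
          (tail ≡ u × head ≡ v) ⊎ (tail ≡ v × head ≡ u) →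
          (tail′ ≡ u′ × head′ ≡ v′) ⊎ (tail′ ≡ v′ × head′ ≡ u′) → ⊥
        same-edge ≡.refl ≡.refl (inj₁ (≡.refl , ≡.refl)) (inj₁ (≡.refl , ≡.refl)) = uv≢u′v′ ≡.refl
        same-edge ≡.refl ≡.refl (inj₂ (≡.refl , ≡.refl)) (inj₂ (≡.refl , ≡.refl)) = uv≢u′v′ ≡.refl
        same-edge ≡.refl ≡.refl (inj₁ (≡.refl , ≡.refl)) (inj₂ (≡.refl , ≡.refl)) = ¬tail≡head uv u′v′ ≡.refl
        same-edge ≡.refl ≡.refl (inj₂ (≡.refl , ≡.refl)) (inj₁ (≡.refl , ≡.refl)) = ¬tail≡head u′v′ uv ≡.refl

      upwardPlanar : UpwardPlanarDrawing zigzag Γ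
      upwardPlanar = record
        { distinct = λ {u} {v} u≢v meet → distinct u≢v meet
        ; planar   = planar
        ; upward   = λ {u} {v} uv _ _ s<t → lerp-increasing {Γ u} {Γ v} (<-by refl (edge-ascends uv)) s<t
        }
        where
        distinct : ∀ {u v} → u ≢ v → ¬ (Γ u ≈ₚ Γ v)
        distinct {u} {v} u≢v meet with ℕ.<-cmp (toℕ u) (toℕ v)
        ... | tri< u<v _ _ = points-distinct u<v meet
        ... | tri≈ _ u≡v _ = u≢v (Fin.toℕ-injective u≡v)
        ... | tri> _ _ v<u = points-distinct v<u (≈ₚ-sym meet)

      realises : Realises zigzag Γ sources-list sinks-list
      realises = record
        { upwardPlanar = upwardPlanar
        ; successors   = λ v → ∈-sources-list v , sources-list-ordered v λ {u} {w} even u↷v v↷w →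
            orient⇒left {1#} {Γ v} {Γ w} {Γ u}
              (<-respʳ (sym (height-1 {Γ v} {Γ u})) (edge-ascends {v} {u} (even , inj₂ u↷v)))
              (<-respʳ (trans (orient-swap (Γ u) (Γ v) (Γ w)) (sym (*-identityˡ _)))
                (turn-at {u} {v} {w} u↷v v↷w))
        ; predecessors = λ v → ∈-sinks-list v , sinks-list-ordered v λ {u} {w} odd u↷v v↷w →
            orient⇒left { - 1#} {Γ v} {Γ u} {Γ w}
              (<-respʳ (sym (height-[-1] {Γ v} {Γ w}))
                (edge-ascends {w} {v} (↷-even {u = v} {w} v↷w odd , inj₂ v↷w)))
              (<-respʳ (trans (-‿cong (orient-cyclic (Γ u) (Γ v) (Γ w)))
                              (solve 1 (λ o → :- o := :- :1 :* o) refl (orient (Γ v) (Γ w) (Γ u))))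
                (turn-at {u} {v} {w} u↷v v↷w))
        }

-- The inward and the outward spiral on a cubic curve.

module CubicSpirals {c ℓ₁ ℓ₂ ℓ₃} (R : RealField c ℓ₁ ℓ₂ ℓ₃) where

  open RealField R
  open Drawings R
  open RealFieldProperties R
  open PlaneGeometry R
  open Segments R
  open Realisations R
  open InfiniteSpirals R

  ½ : Carrier
  ½ = proj₁ (inverse 0<2)

  0<½ : 0# < ½
  0<½ = proj₁ (proj₂ (inverse 0<2))

  2*½≈1 : 2# * ½ ≈ 1#
  2*½≈1 = proj₂ (proj₂ (inverse 0<2))

  -- (- q) ^ i
  power : Carrier → ℕ → Carrier
  power q zero    = 1#
  power q (suc i) = - (q * power q i)

  cubic : Carrier → Carrier → Point
  cubic η x = η * x , - (x * x * x)

  -- Both spirals run along a cubic curve, whose tangent at the point with parameter x meets it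
  -- again at the parameter - 2 x; hence all edges are on tangents.
  inward outward : ℕ → Point
  inward  i = cubic 1# (power ½ i)
  outward i = cubic (- 1#) (power 2# i)

  private
    0<3 : 0# < 2# + 1#
    0<3 = +-pos 0<2 0<1

  opaque
    power-+ : ∀ q m i → power q (m ℕ.+ i) ≈ power q i * power q m
    power-+ q zero    i = sym (*-identityʳ _)
    power-+ q (suc m) i = trans (-‿cong (*-congˡ (power-+ q m i)))
      (solve 3 (λ q x y → :- (q :* (x :* y)) := x :* :- (q :* y)) refl q (power q i) (power q m))

    power-inverse : ∀ m i → power 2# i ≈ power 2# (m ℕ.+ i) * power ½ m
    power-inverse zero    i = sym (*-identityʳ _)
    power-inverse (suc m) i = begin
      power 2# i                                   ≈⟨ power-inverse m i ⟩
      power 2# (m ℕ.+ i) * power ½ m               ≈⟨ *-identityʳ _ ⟨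
      power 2# (m ℕ.+ i) * power ½ m * 1#          ≈⟨ *-congˡ 2*½≈1 ⟨
      power 2# (m ℕ.+ i) * power ½ m * (2# * ½)
        ≈⟨ solve 4 (λ t h x y → x :* y :* (t :* h) := :- (t :* x) :* :- (h :* y)) refl
             2# ½ (power 2# (m ℕ.+ i)) (power ½ m) ⟩
      power 2# (suc m ℕ.+ i) * power ½ (suc m)     ∎
      where open SetoidReasoning setoid

    contract : ∀ {x} → 0# ≤ 1# + x → 0# ≤ 1# - x → 0# < 1# + - (½ * x) × 0# < 1# - - (½ * x)
    contract {x} 0≤1+x 0≤1-x =
        <-respʳ (trans (solve 2 (λ h x → h :* (:1 :+ (:1 :- x)) := :2 :* h :+ :- (h :* x)) refl ½ x)
                       (+-congʳ 2*½≈1))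
                (*-pos 0<½ (+-posˡ 0<1 0≤1-x))
      , <-respʳ (trans (solve 2 (λ h x → h :* (:1 :+ (:1 :+ x)) := :2 :* h :- :- (h :* x)) refl ½ x)
                       (+-congʳ 2*½≈1))
                (*-pos 0<½ (+-posˡ 0<1 0≤1+x))

    power-½-bounded : ∀ m → 0# < 1# + power ½ (suc m) × 0# < 1# - power ½ (suc m)
    power-½-bounded zero    = contract (<⇒≤ 0<2) (≈⇒≤ (sym (-‿inverseʳ 1#)))
    power-½-bounded (suc m) = let 0<1+x , 0<1-x = power-½-bounded m in contract (<⇒≤ 0<1+x) (<⇒≤ 0<1-x)

    sign-power-pos : ∀ {q} → 0# < q → ∀ i → 0# < sign i * power q i × 0# < power q i * power q i
    sign-power-pos 0<q zero = <-respʳ (sym (*-identityʳ 1#)) 0<1 , <-respʳ (sym (*-identityʳ 1#)) 0<1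
    sign-power-pos {q} 0<q (suc i) =
      let 0<σx , 0<x² = sign-power-pos 0<q i in
        <-respʳ (trans (solve 3 (λ q σ x → q :* (σ :* x) := :- σ :* :- (q :* x)) refl q (sign i) (power q i))
                       (*-congʳ (sym (sign-suc i))))
                (*-pos 0<q 0<σx)
      , <-respʳ (solve 2 (λ q x → q :* q :* (x :* x) := :- (q :* x) :* :- (q :* x)) refl q (power q i))
                (*-pos (*-pos 0<q 0<q) 0<x²)

    cubic-rises : ∀ {q} → 0# < q → ∀ η i →
      0# < height (sign i) (cubic η (power q i)) (cubic η (power q (suc i)))
    cubic-rises {q} 0<q η i =
      let 0<σx , 0<x² = sign-power-pos 0<q i in
      <-respʳ (solve 3 (λ q σ x →
                 σ :* x :* ((:1 :+ q :* q :* q) :* (x :* x)) :=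
                 σ :* (:- (:- (q :* x) :* :- (q :* x) :* :- (q :* x)) :- (:- (x :* x :* x)))) refl
                 q (sign i) (power q i))
        (*-pos 0<σx (*-pos (+-pos 0<1 (*-pos (*-pos 0<q 0<q) 0<q)) 0<x²))

    cubic-cong : ∀ {η x y} → x ≈ y → cubic η x ≈ₚ cubic η y
    cubic-cong x≈y = *-congˡ x≈y , -‿cong (*-cong (*-cong x≈y x≈y) x≈y)

    private
      -- The cubic minus its tangent at z has the double zero z and the simple zero -2z, so at zk it
      -- is z³ (1 - k)² (2 + k) up to sign. The remaining factor 3z is the horizontal extent of the
      -- edge between -2z and z.
      tangent-pos : ∀ {z k} → 0# < z * z → 0# < 1# + k → 0# < 1# - k →
        0# < (2# + 1#) * (z * z) * (z * z) * (1# + (1# + k)) * ((1# - k) * (1# - k))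
      tangent-pos 0<z² 0<1+k 0<1-k =
        *-pos (*-pos (*-pos (*-pos 0<3 0<z²) 0<z²) (+-pos 0<1 0<1+k)) (*-pos 0<1-k 0<1-k)

      :orient-cubic : ∀ {n} (η x y z : Polynomial n) → Polynomial n
      :orient-cubic η x y z =
        (η :* y :- η :* x) :* (:- (z :* z :* z) :- :- (x :* x :* x)) :-
        (:- (y :* y :* y) :- :- (x :* x :* x)) :* (η :* z :- η :* x)

    inward-tangent : ∀ {x z w k} → - (2# * z) ≈ x → z * k ≈ w →
      0# < z * z → 0# < 1# + k → 0# < 1# - k →
      Clockwise (cubic 1# x) (cubic 1# z) (cubic 1# w)
    inward-tangent {x} {z} {w} {k} x≈ w≈ 0<z² 0<1+k 0<1-k =
      <-respʳ (trans (solve 2 (λ z k →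
                        (:2 :+ :1) :* (z :* z) :* (z :* z) :* (:1 :+ (:1 :+ k)) :* ((:1 :- k) :* (:1 :- k)) :=
                        :- :orient-cubic :1 (:- (:2 :* z)) z (z :* k)) refl z k)
                     (-‿cong (orient-cong {q = cubic 1# z} (cubic-cong x≈) (refl , refl) (cubic-cong w≈))))
        (tangent-pos 0<z² 0<1+k 0<1-k)

    -- The edge now leaves its point of tangency instead of arriving there. This reversal would
    -- change the sense of the turn, and the reflection η = -1 restores it.
    outward-tangent : ∀ {z w k} → z * k ≈ w →
      0# < z * z → 0# < 1# + k → 0# < 1# - k →
      Clockwise (cubic (- 1#) z) (cubic (- 1#) (- (2# * z))) (cubic (- 1#) w)
    outward-tangent {z} {w} {k} w≈ 0<z² 0<1+k 0<1-k =
      <-respʳ (trans (solve 2 (λ z k →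
                        (:2 :+ :1) :* (z :* z) :* (z :* z) :* (:1 :+ (:1 :+ k)) :* ((:1 :- k) :* (:1 :- k)) :=
                        :- :orient-cubic (:- :1) z (:- (:2 :* z)) (z :* k)) refl z k)
                     (-‿cong (orient-cong {cubic (- 1#) z} {q = cubic (- 1#) (- (2# * z))}
                       (refl , refl) (refl , refl) (cubic-cong w≈))))
        (tangent-pos 0<z² 0<1+k 0<1-k)

    -- Edge i touches the cubic at vertex i + 1, with parameter z say. A later vertex has parameter
    -- zk with k a positive power of -1/2, so |k| < 1. All later vertices thus lie on one side of
    -- the edge, which yields both the turns and the disjointness.
    inward-clockwise : ∀ {i j} → suc i ℕ.< j → Clockwise (inward i) (inward (suc i)) (inward j)
    inward-clockwise {i} {j} i+1<j with ℕ.m≤n⇒∃[o]m+o≡n i+1<j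
    ... | m , ≡.refl = let 0<1+k , 0<1-k = power-½-bounded m in inward-tangent {k = power ½ (suc m)}
      (trans (solve 3 (λ t h x → :- (t :* :- (h :* x)) := t :* h :* x) refl 2# ½ (power ½ i))
             (trans (*-congʳ 2*½≈1) (*-identityˡ _)))
      (trans (sym (power-+ ½ (suc m) (suc i)))
             (reflexive (≡.cong (power ½ ∘ suc) (ℕ.+-comm m (suc i)))))
      (proj₂ (sign-power-pos 0<½ (suc i))) 0<1+k 0<1-k

    -- Edge j touches the cubic at vertex j, and relative to its parameter the earlier vertices have
    -- ratios k with |k| < 1; so it is the earlier vertices that lie on one side.
    outward-clockwise : ∀ {i j} → i ℕ.< j → Clockwise (outward j) (outward (suc j)) (outward i)
    outward-clockwise {i} {j} i<j with ℕ.m≤n⇒∃[o]m+o≡n i<j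
    ... | m , ≡.refl = let 0<1+k , 0<1-k = power-½-bounded m in outward-tangent {k = power ½ (suc m)}
      (trans (*-congʳ (reflexive (≡.cong (power 2# ∘ suc) (ℕ.+-comm i m))))
             (sym (power-inverse (suc m) i)))
      (proj₂ (sign-power-pos 0<2 j)) 0<1+k 0<1-k

    outward-counterclockwise : ∀ i → 0# ≤ orient (outward i) (outward (1 ℕ.+ i)) (outward (3 ℕ.+ i))
    outward-counterclockwise i =
      -- Three steps outward the ratio is k = (-2)³ = -8, where 2 + k is negative; the constant is
      -- -3 (2 + k) (1 - k)² = 2 · 3² · 3⁴.
      ≤-respʳ (solve 1 (λ z →
                 let :3 = :2 :+ :1; :t = λ z → :- (:2 :* z) in
                 :2 :* (:3 :* :3) :* (:3 :* :3 :* (:3 :* :3)) :* (z :* z :* (z :* z)) :=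
                 :orient-cubic (:- :1) z (:t z) (:t (:t (:t z)))) refl (power 2# i))
        (*-nonNeg (<⇒≤ (*-pos (*-pos 0<2 (*-pos 0<3 0<3)) (*-pos (*-pos 0<3 0<3) (*-pos 0<3 0<3))))
                  (square-nonNeg _))

  inward-spiral : InfiniteSpiral inward
  inward-spiral = record
    { rises = cubic-rises 0<½ 1#
    ; turns = λ i → inward-clockwise {i} ℕ.≤-refl
    ; apart = λ {i} {j} i+1<j → separated
        (inward-clockwise {i} {j} i+1<j)
        (inward-clockwise {i} {suc j} (ℕ.m<n⇒m<1+n i+1<j))
    }

  outward-spiral : InfiniteSpiral outward
  outward-spiral = record
    { rises = cubic-rises 0<2 (- 1#)
    ; turns = λ i → <-respʳ (-‿cong (sym (orient-cyclic (outward i) _ _)))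
        (outward-clockwise {i} {suc i} ℕ.≤-refl)
    ; apart = λ {i} {j} i+1<j → Disjoint-sym (separated
        (outward-clockwise {i} {j} (ℕ.<-trans ℕ.≤-refl i+1<j))
        (outward-clockwise {suc i} {j} i+1<j))
    }

-- Critical triples and the count of steps.

private
  v₀ v₁ v₂ v₃ : ∀ {m} → Fin m → Fin (3 ℕ.+ m)
  v₀ i = inject₁ (inject₁ (inject₁ i))
  v₁ i = Fin.suc (inject₁ (inject₁ i))
  v₂ i = Fin.suc (Fin.suc (inject₁ i))
  v₃ i = Fin.suc (Fin.suc (Fin.suc i))

  v₀↷v₁ : ∀ {m} (i : Fin m) → v₀ i ↷ v₁ i
  v₀↷v₁ i = ≡.cong suc (≡.sym (Fin.toℕ-inject₁ _))

  v₁↷v₂ : ∀ {m} (i : Fin m) → v₁ i ↷ v₂ i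
  v₁↷v₂ i = ≡.cong (suc ∘ suc) (≡.sym (Fin.toℕ-inject₁ _))

  v₂↷v₃ : ∀ {m} (i : Fin m) → v₂ i ↷ v₃ i
  v₂↷v₃ i = ≡.cong (suc ∘ suc ∘ suc) (≡.sym (Fin.toℕ-inject₁ _))

  toℕ-v₃ : ∀ {m} (i : Fin m) → toℕ (v₃ i) ≡ 3 ℕ.+ toℕ (v₀ i)
  toℕ-v₃ i = ≡.trans (v₂↷v₃ i) (≡.cong suc (≡.trans (v₁↷v₂ i) (≡.cong suc (v₀↷v₁ i))))

module Counting {c ℓ₁ ℓ₂ ℓ₃} (R : RealField c ℓ₁ ℓ₂ ℓ₃) where

  open RealField R
  open Drawings R
  open RealFieldProperties R
  open PlaneGeometry R
  open Segments R
  open Realisations R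
  open InfiniteSpirals R
  open CubicSpirals R

  module _ {m : ℕ} where

    Realised : Drawing (3 ℕ.+ m) → Set (c ⊔ ℓ₁ ⊔ ℓ₃)
    Realised Γ = Realises zigzag Γ sources-list sinks-list

    σ : Fin m → Carrier
    σ i = sign (toℕ (v₀ i))

    -- The height from `v₀` to `v₃` is h₀ - h₁ + h₂, and `Inward` says δ < α.
    Critical Inward : Drawing (3 ℕ.+ m) → Fin m → Set ℓ₃
    Critical Γ i = height (σ i) (Γ (v₀ i)) (Γ (v₃ i)) ≤ 0#
    Inward Γ i   = Clockwise (Γ (v₀ i)) (Γ (v₁ i)) (Γ (v₃ i))

    spiral-at : ∀ {Γ} → Realised Γ → ∀ i → Spiral (σ i) (Γ (v₀ i)) (Γ (v₁ i)) (Γ (v₂ i)) (Γ (v₃ i))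
    spiral-at Γ-realised i = spiral Γ-realised (v₀↷v₁ i) (v₁↷v₂ i) (v₂↷v₃ i)

    -- `Critical` is a negation, so its failure gives a positive height only up to double negation.
    -- `Inward` is therefore carried along double-negated, and the heights are used where the goal
    -- is `⊥`.
    persists : ∀ {Γ Γ′ i} → (∀ {t} → UnitInterval t → Realised (linearMorph Γ Γ′ t)) →
      ¬ Critical Γ i → ¬ Critical Γ′ i → ¬ ¬ Inward Γ i → ¬ ¬ Inward Γ′ i
    persists {i = i} morph ¬crit ¬crit′ ¬¬in ¬in′ =
      ¬crit λ 0<h → ¬crit′ λ 0<h′ → ¬¬in λ in₀ →
      no-flip (λ unit → spiral-at (morph unit) i) 0<h 0<h′ in₀ (¬in′ ∘ neg-pos)

    module _ {Γ} (Γ-realised : Realised Γ) where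

      first middle last : Fin m → Carrier
      first i  = height (σ i) (Γ (v₀ i)) (Γ (v₁ i))
      middle i = height (σ i) (Γ (v₂ i)) (Γ (v₁ i))
      last i   = height (σ i) (Γ (v₂ i)) (Γ (v₃ i))

      opaque
        last<middle : ∀ i → Critical Γ i → last i < middle i
        last<middle i crit = <-by
          (solve 5 (λ σ y₀ y₁ y₂ y₃ → σ :* (y₁ :- y₂) :- σ :* (y₃ :- y₂) :=
                                      σ :* (y₁ :- y₀) :+ (:0 :- σ :* (y₃ :- y₀))) refl
            (σ i) (yOf (Γ (v₀ i))) (yOf (Γ (v₁ i))) (yOf (Γ (v₂ i))) (yOf (Γ (v₃ i))))
          (+-posˡ (Spiral.height₀ (spiral-at Γ-realised i)) (≤⇒0≤- crit))

        first<middle : ∀ i → Critical Γ i → first i < middle i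
        first<middle i crit = <-by
          (solve 5 (λ σ y₀ y₁ y₂ y₃ → σ :* (y₁ :- y₂) :- σ :* (y₁ :- y₀) :=
                                      σ :* (y₃ :- y₂) :+ (:0 :- σ :* (y₃ :- y₀))) refl
            (σ i) (yOf (Γ (v₀ i))) (yOf (Γ (v₁ i))) (yOf (Γ (v₂ i))) (yOf (Γ (v₃ i))))
          (+-posˡ (Spiral.height₂ (spiral-at Γ-realised i)) (≤⇒0≤- crit))

      -- Unimodality: once the heights stop increasing they cannot increase again, or the edge in
      -- between would be a shortest middle one.
      descends : ∀ i → middle i ≤ first i → last i ≤ middle i
      descends i middle≤first middle<last =
        middle-not-shortest (spiral-at Γ-realised i) middle≤first (<⇒≤ middle<last)

  -- The middle edge of a critical triple is strictly higher than both others. From triple i on the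
  -- heights descend, so the middle edge of triple j cannot exceed its first.
  critical-unique : ∀ {m Γ} → Realised Γ → ∀ {i j : Fin m} → i Fin.< j → Critical Γ i → ¬ Critical Γ j
  critical-unique {suc m} {Γ} Γ-realised {i} {Fin.suc j} i<j crit-i crit-j =
    middle≤first (first<middle Γ-realised (Fin.suc j) crit-j)
    where
    σ-suc : ∀ j → σ (Fin.suc j) ≈ - σ (inject₁ j)
    σ-suc j = trans (reflexive (≡.cong sign (v₀↷v₁ (inject₁ j)))) (sign-suc (toℕ (v₀ (inject₁ j))))
    flip-height : ∀ j p q → height (σ (inject₁ j)) q p ≈ height (σ (Fin.suc j)) p q
    flip-height j p q = trans (sym (height-neg (σ (inject₁ j)) p q)) (*-congʳ (sym (σ-suc j)))
    -- The middle and last edges of a triple are the first and middle edges of the next, with the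
    -- sign of the heights and the order of the ends both reversed.
    shift : ∀ j → last Γ-realised (inject₁ j) ≤ middle Γ-realised (inject₁ j) →
      middle Γ-realised (Fin.suc j) ≤ first Γ-realised (Fin.suc j)
    shift j = ≤-respʳ (flip-height j (Γ (v₁ (inject₁ j))) (Γ (v₂ (inject₁ j))))
            ∘ ≤-respˡ (flip-height j (Γ (v₃ (inject₁ j))) (Γ (v₂ (inject₁ j))))
    middle≤first : middle Γ-realised (Fin.suc j) ≤ first Γ-realised (Fin.suc j)
    middle≤first = shift j (<-weakInduction-startingFrom
      (λ j → last Γ-realised j ≤ middle Γ-realised j)
      (<⇒≤ (last<middle Γ-realised i crit-i))
      (λ j → descends Γ-realised (Fin.suc j) ∘ shift j)
      (≡.subst (toℕ i ℕ.≤_) (≡.sym (Fin.toℕ-inject₁ j)) (ℕ.s≤s⁻¹ i<j)))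

  zigzag-plane : ∀ n → UpwardPlaneGraph n
  zigzag-plane n = record
    { digraph    = zigzag
    ; 𝒮          = sources-list
    ; 𝒫          = sinks-list
    ; realisable = inward ∘ toℕ , realises inward-spiral
    }

  module _ {m k} (morph : UpwardPlanarMorph (zigzag-plane (3 ℕ.+ m)) k (inward ∘ toℕ) (outward ∘ toℕ)) where
    open UpwardPlanarMorph morph

    -- If the triple were critical in no `Λ a`, then `Inward` would survive all k steps, against the
    -- orientation in the outward spiral.
    becomes-critical : ∀ i → ¬ ¬ (∃[ a ] Critical (Λ a) i)
    becomes-critical i never = <-weakInduction (λ a → ¬ ¬ Inward (Λ a) i)
      (λ ¬in → ¬in inward₀)
      (λ a → persists (step a) (never ∘ (inject₁ a ,_)) (never ∘ (Fin.suc a ,_)))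
      (Fin.fromℕ k)
      (λ in₁ → outward₁ (pos-neg in₁))
      where
      inward₀ : Inward (Λ Fin.zero) i
      inward₀ = <-respʳ (-‿cong (orient-cong (≈ₚ-sym (start _)) (≈ₚ-sym (start _)) (≈ₚ-sym (start _))))
        (≡.subst₂ (λ a b → Clockwise (inward (toℕ (v₀ i))) (inward a) (inward b))
          (≡.sym (v₀↷v₁ i)) (≡.sym (toℕ-v₃ i)) (inward-clockwise {toℕ (v₀ i)} (ℕ.n≤1+n _)))
      outward₁ : 0# ≤ orient (Λ (Fin.fromℕ k) (v₀ i)) (Λ (Fin.fromℕ k) (v₁ i)) (Λ (Fin.fromℕ k) (v₃ i))
      outward₁ = ≤-respʳ (orient-cong (≈ₚ-sym (end _)) (≈ₚ-sym (end _)) (≈ₚ-sym (end _)))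
        (≡.subst₂ (λ a b → 0# ≤ orient (outward (toℕ (v₀ i))) (outward a) (outward b))
          (≡.sym (v₀↷v₁ i)) (≡.sym (toℕ-v₃ i)) (outward-counterclockwise (toℕ (v₀ i))))

    -- The inequality is decidable, so its failure may be refuted with the goal `⊥`. There the
    -- finitely many double negations can be removed together, and the pigeonhole principle puts two
    -- critical triples into one drawing.
    m≤k+1 : m ℕ.≤ suc k
    m≤k+1 with m ℕ.≤? suc k
    ... | yes m≤k+1 = m≤k+1
    ... | no  m≰k+1 = ⊥-elim (Fin.sequence (RawMonad.rawApplicative ¬¬-Monad) becomes-critical λ critical →
      let i , j , i<j , same = Fin.pigeonhole (ℕ.≰⇒> m≰k+1) (proj₁ ∘ critical) in
      critical-unique (drawing _) i<j (proj₂ (critical i))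
        (≡.subst (λ a → Critical (Λ a) j) (≡.sym same) (proj₂ (critical j))))

  n≤4+k : ∀ {n k} → 8 ℕ.≤ n →
    UpwardPlanarMorph (zigzag-plane n) k (inward ∘ toℕ) (outward ∘ toℕ) → n ℕ.≤ 4 ℕ.+ k
  n≤4+k (ℕ.s≤s (ℕ.s≤s (ℕ.s≤s _))) morph = ℕ.+-monoʳ-≤ 3 (m≤k+1 morph)

  opaque
    -- The n - 3 triples and k + 1 drawings give n ≤ k + 4. For n ≥ 8 this forces k ≥ 4, so the
    -- additive constant is absorbed and n ≤ 2k; hence the constants 1/2 and 8.
    lower-bound : ∀ {n k} → 8 ℕ.≤ n →
      UpwardPlanarMorph (zigzag-plane n) k (inward ∘ toℕ) (outward ∘ toℕ) → ½ * fromNat n ≤ fromNat k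
    lower-bound {n} {k} 8≤n morph =
      ≤-by (trans (+-congʳ (trans (sym (*-identityˡ _)) (*-congʳ (sym 2*½≈1))))
                  (solve 3 (λ h n k → :2 :* h :* k :- h :* n := h :* (k :+ k :- n)) refl
                    ½ (fromNat n) (fromNat k)))
        (*-nonNeg (<⇒≤ 0<½) (≤⇒0≤- (≤-respʳ (fromNat-+ k k) (fromNat-mono-≤ n≤k+k))))
      where
      4≤k : 4 ℕ.≤ k
      4≤k = ℕ.+-cancelˡ-≤ 4 4 k (ℕ.≤-trans 8≤n (n≤4+k 8≤n morph))
      n≤k+k : n ℕ.≤ k ℕ.+ k
      n≤k+k = ℕ.≤-trans (n≤4+k 8≤n morph) (ℕ.+-monoˡ-≤ k 4≤k)

theorem1 :
  ∀ {c ℓ₁ ℓ₂ ℓ₃} (R : RealField c ℓ₁ ℓ₂ ℓ₃) →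
  let open RealField R
      open Drawings R
      open UpwardPlaneGraph
  in
  Σ[ κ ∈ Carrier ] Σ[ n₀ ∈ ℕ ] (0# < κ) × (∀ n → n₀ ℕ.≤ n →
    Σ[ P ∈ UpwardPlaneGraph n ]
      UnderlyingPath (digraph P) ×
      (Σ[ Γ₀ ∈ Drawing n ] Σ[ Γ₁ ∈ Drawing n ]
        IsDrawing P Γ₀ × IsDrawing P Γ₁ ×
        (∀ k → UpwardPlanarMorph P k Γ₀ Γ₁ →
          κ * fromNat n ≤ fromNat k)))
theorem1 R =
  ½ , 8 , 0<½ , λ n 8≤n →
    zigzag-plane n , zigzag-path ,
    inward ∘ toℕ , outward ∘ toℕ , realises inward-spiral , realises outward-spiral ,
    λ k → lower-bound 8≤n
  where
  open InfiniteSpirals R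
  open CubicSpirals R
  open Counting R
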